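{- There exists a constant $c$ such that every acyclic oriented graph $H$ in which every vertex has out-degree at most $2$ satisfies $\tau(H)\le c\,p(H)^4$.
   Context: An oriented graph is a directed graph with no loops in which any two vertices are joined by at most one arc; a tournament is an orientation of a complete graph. A homomorphism $H\to T$ is a map $f:V(H)\to V(T)$ such that $f(u)f(v)$ is an arc of $T$ for every arc $uv$ of $H$. The compressibility $\tau(H)$ is the smallest $k\in\mathbb N$ such that for every tournament $T$ on $k$ vertices there is a homomorphism $H\to T$ ($\infty$ if none exists). For an acyclic oriented graph $H$, $p(H)$ is the maximum number of vertices of a directed path in $H$. -}

module Defs where

open import Data.Nat using (ℕ; zero; suc; _≤_; _*_; _^_)
open import Data.Fin using (Fin; toℕ)
open import Data.Bool using (Bool; true; false; T)
open import Data.List using (length; filterᵇ; allFin)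
open import Data.Product using (Σ; _×_; ∃; ∃-syntax)
open import Data.Sum using (_⊎_)
open import Relation.Nullary using (¬_)
open import Relation.Binary.PropositionalEquality using (_≡_; _≢_)
open import Function.Definitions using (Injective)

Digraph : ℕ → Set
Digraph n = Fin n → Fin n → Bool

Arc : ∀ {n} → Digraph n → Fin n → Fin n → Set
Arc G u v = T (G u v)

IsOriented : ∀ {n} → Digraph n → Set
IsOriented G = (∀ u → ¬ Arc G u u) × (∀ u v → Arc G u v → ¬ Arc G v u)

IsTournament : ∀ {n} → Digraph n → Set
IsTournament G = IsOriented G × (∀ u v → u ≢ v → Arc G u v ⊎ Arc G v u)

IsHom : ∀ {n k} → Digraph n → Digraph k → (Fin n → Fin k) → Set
IsHom H T' f = ∀ u v → Arc H u v → Arc T' (f u) (f v)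

AllTournamentsOn : ∀ {n} → Digraph n → ℕ → Set
AllTournamentsOn H k = (T' : Digraph k) → IsTournament T' → ∃[ f ] IsHom H T' f

-- τ(H) ≤ m : the least k with AllTournamentsOn H k exists and is ≤ m,
-- equivalently some k ≤ m has the property.
τ≤ : ∀ {n} → Digraph n → ℕ → Set
τ≤ H m = ∃[ k ] (k ≤ m × AllTournamentsOn H k)

DirPath : ∀ {n} → Digraph n → ℕ → Set
DirPath {n} G m =
  Σ (Fin m → Fin n) λ v →
    Injective _≡_ _≡_ v × (∀ i j → toℕ j ≡ suc (toℕ i) → Arc G (v i) (v j))

DirCycle : ∀ {n} → Digraph n → Set
DirCycle {n} G =
  Σ ℕ λ m → Σ (Fin (suc m) → Fin n) λ v →
    Injective _≡_ _≡_ v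
    × (∀ i j → toℕ j ≡ suc (toℕ i) → Arc G (v i) (v j))
    × (∀ i → toℕ i ≡ m → Arc G (v i) (v Fin.zero))

IsAcyclic : ∀ {n} → Digraph n → Set
IsAcyclic G = ¬ DirCycle G

outDeg : ∀ {n} → Digraph n → Fin n → ℕ
outDeg {n} G u = length (filterᵇ (G u) (allFin n))

IsMaxPathSize : ∀ {n} → Digraph n → ℕ → Set
IsMaxPathSize G p = DirPath G p × (∀ m → DirPath G m → m ≤ p)

{-# OPTIONS --safe #-}
module Submission where

-- Call two vertices of a set A bad if they have no common in-neighbour in A. If matchings of bad pairs are always
-- small, deleting them p − 1 times leaves nested levels A₁ ⊂ … ⊂ A_p such that any two vertices of a level have a
-- common in-neighbour in the next one, and H maps into this tower greedily by height. Otherwise there is a matching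
-- of order p³ bad pairs {x , y}; any two of these span a directed 4-cycle, so x and y have opposite adjacencies to
-- all other pairs. Choose one vertex from each pair of a subfamily at random: any two chosen vertices have a common
-- in-neighbour, which again gives a tower, unless two pairs are near-twins, agreeing up to swapping on all but
-- L = O(p) of the others. Merging near-twins repeatedly produces a cluster of order p vertices to which most of the
-- remaining pairs are homogeneous. A cluster is transitive, which gives a tower, or contains a cyclic triangle. Three
-- mutually homogeneous triangles, some of them replaced by their antipodes, form the lexicographic product C₃[C₃],
-- where any two vertices have a common in-neighbour.

open import Defs
open import Data.Nat using (ℕ; zero; suc; _≤_; _<_; _+_; _*_; _^_; _≤?_; _<?_; z≤n; s≤s; s≤s⁻¹; >-nonZero)
open import Data.Nat.Properties hiding (_≟_)
open import Data.Nat.Induction using (<-rec)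
open import Data.Nat.Tactic.RingSolver using (solve-∀)
open import Data.Bool using (if_then_else_)
open import Data.Bool.Properties using (T?)
open import Data.Fin as Fin using (Fin; toℕ)
open import Data.Fin.Properties using (any?; toℕ<n; toℕ-injective)
open import Data.List using (List; []; _∷_; _++_; length; map; filter; filterᵇ; allFin; cartesianProduct; concat; take)
open import Data.List.Properties using (length-map; length-++; length-tabulate; length-take; length-filter)
open import Data.List.Membership.Propositional using (_∈_; find; lose)
open import Data.List.Membership.Propositional.Properties using
  (∈-filter⁺; ∈-filter⁻; ∈-allFin; ∈-map⁺; ∈-map⁻; ∈-++⁺ˡ; ∈-++⁺ʳ; ∈-++⁻; ∈-∃++; ∈-cartesianProduct⁺)
open import Data.List.Relation.Unary.Any as Any using (Any; here; there)
open import Data.List.Relation.Unary.All as All using (All; []; _∷_)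
import Data.List.Relation.Unary.All.Properties as All
open import Data.List.Relation.Unary.AllPairs as AllPairs using (AllPairs; []; _∷_)
import Data.List.Relation.Unary.AllPairs.Properties as AllPairs
open import Data.List.Relation.Unary.Unique.Propositional using (Unique)
open import Data.List.Relation.Unary.Unique.Propositional.Properties using (allFin⁺)
open import Data.List.Relation.Binary.Pointwise using (Pointwise; []; _∷_; Pointwise-length)
open import Data.List.Relation.Binary.Permutation.Propositional using (_↭_; refl; prep; swap; trans; ↭-sym; ↭⇒↭ₛ)
open import Data.List.Relation.Binary.Permutation.Propositional.Properties using
  (All-resp-↭; ∈-resp-↭; ↭-length; shift; map⁺; filter-↭)
import Data.List.Relation.Binary.Permutation.Setoid.Properties as SetoidPermutation
open import Data.Product using (∃-syntax; Σ; _×_; _,_; proj₁; proj₂)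
open import Data.Sum using (_⊎_; inj₁; inj₂; [_,_]′)
open import Data.Unit using (⊤; tt)
open import Function using (_∘_; id)
open import Function.Definitions using (Injective)
open import Level using (0ℓ)
open import Relation.Nullary using (¬_; Dec; yes; no; does; contradiction)
open import Relation.Nullary.Decidable using (_×-dec_; _⊎-dec_; ¬?; decidable-stable)
open import Relation.Unary using (Pred; Decidable)
open import Relation.Binary using (Rel; Symmetric; tri<; tri≈; tri>)
import Relation.Binary.Definitions as Binary
open import Relation.Binary.PropositionalEquality using (_≡_; _≢_; refl; sym; cong; cong₂; subst; setoid) renaming (trans to ≡-trans)

-- Permutations, pair search and counting in lists

∈⇒↭ : ∀ {A : Set} {x : A} {xs} → x ∈ xs → ∃[ zs ] xs ↭ x ∷ zs
∈⇒↭ {x = x} x∈xs with ys , zs , refl ← ∈-∃++ x∈xs = ys ++ zs , shift x ys zs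

-- The pair comes with a permutation bringing it to the front, so that arguments which delete or
-- merge a pair can go on with `zs`.
findPair : ∀ {A : Set} {R : Rel A 0ℓ} → Binary.Decidable R → ∀ xs →
           (∃[ x ] ∃[ y ] ∃[ zs ] (xs ↭ x ∷ y ∷ zs × R x y)) ⊎ AllPairs (λ x y → ¬ R x y) xs
findPair R? [] = inj₂ []
findPair R? (x ∷ xs) with findPair R? xs
... | inj₁ (y , z , zs , σ , r) =
  inj₁ (y , z , x ∷ zs , trans (prep x σ) (trans (swap x y refl) (prep y (swap x z refl))) , r)
... | inj₂ ap with Any.any? (R? x) xs
...   | no ¬r = inj₂ (All.¬Any⇒All¬ xs ¬r ∷ ap)
...   | yes r with y , y∈xs , xRy ← find r with zs , σ ← ∈⇒↭ y∈xs = inj₁ (x , y , zs , prep x σ , xRy)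

AllPairs-resp-↭ : ∀ {A : Set} {R : Rel A 0ℓ} → Symmetric R → ∀ {xs ys} → xs ↭ ys → AllPairs R xs → AllPairs R ys
AllPairs-resp-↭ s σ = SetoidPermutation.AllPairs-resp-↭ (setoid _) s ((λ { refl r → r }) , (λ { refl r → r })) (↭⇒↭ₛ σ)

AllPairs-lookup : ∀ {A : Set} {R : Rel A 0ℓ} → Symmetric R → ∀ {xs x y} → AllPairs R xs →
                  x ∈ xs → y ∈ xs → x ≡ y ⊎ R x y
AllPairs-lookup s (a ∷ ap) (here refl) (here refl) = inj₁ refl
AllPairs-lookup s (a ∷ ap) (here refl) (there y∈) = inj₂ (All.lookup a y∈)
AllPairs-lookup s (a ∷ ap) (there x∈) (here refl) = inj₂ (s (All.lookup a x∈))
AllPairs-lookup s (a ∷ ap) (there x∈) (there y∈) = AllPairs-lookup s ap x∈ y∈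

count : ∀ {A : Set} {P : Pred A 0ℓ} → Decidable P → List A → ℕ
count P? xs = length (filter P? xs)

count-mono : ∀ {A : Set} {P Q : Pred A 0ℓ} (P? : Decidable P) (Q? : Decidable Q) →
             (∀ {x} → P x → Q x) → ∀ xs → count P? xs ≤ count Q? xs
count-mono P? Q? P⊆Q [] = z≤n
count-mono P? Q? P⊆Q (x ∷ xs) with P? x | Q? x
... | yes p | yes q = s≤s (count-mono P? Q? P⊆Q xs)
... | yes p | no ¬q = contradiction (P⊆Q p) ¬q
... | no ¬p | yes q = m≤n⇒m≤1+n (count-mono P? Q? P⊆Q xs)
... | no ¬p | no ¬q = count-mono P? Q? P⊆Q xs

count-↭ : ∀ {A : Set} {P : Pred A 0ℓ} (P? : Decidable P) {xs ys} → xs ↭ ys → count P? xs ≡ count P? ys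
count-↭ P? σ = ↭-length (filter-↭ P? σ)

partitionAll : ∀ {A : Set} {R : Rel A 0ℓ} {P Q : Pred A 0ℓ} {xs} → All (λ x → P x ⊎ Q x) xs → AllPairs R xs →
               ∃[ ys ] ∃[ zs ] (length ys + length zs ≡ length xs × (All P ys × AllPairs R ys × (∀ {x} → x ∈ ys → x ∈ xs))
                                                                 × (All Q zs × AllPairs R zs × (∀ {x} → x ∈ zs → x ∈ xs)))
partitionAll [] [] = [] , [] , refl , ([] , [] , λ ()) , ([] , [] , λ ())
partitionAll {xs = x ∷ _} (pq ∷ pqs) (r ∷ rs)
  with ys , zs , len , (ps , rys , ⊆ys) , (qs , rzs , ⊆zs) ← partitionAll pqs rs | pq
... | inj₁ p = x ∷ ys , zs , cong suc len ,
               (p ∷ ps , All.tabulate (λ y∈ → All.lookup r (⊆ys y∈)) ∷ rys ,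
                λ { (here refl) → here refl ; (there y∈) → there (⊆ys y∈) }) ,
               (qs , rzs , λ z∈ → there (⊆zs z∈))
... | inj₂ q = ys , x ∷ zs , ≡-trans (+-suc (length ys) (length zs)) (cong suc len) ,
               (ps , rys , λ y∈ → there (⊆ys y∈)) ,
               (q ∷ qs , All.tabulate (λ z∈ → All.lookup r (⊆zs z∈)) ∷ rzs ,
                λ { (here refl) → here refl ; (there z∈) → there (⊆zs z∈) })

count-∷ : ∀ {A : Set} {P : Pred A 0ℓ} (P? : Decidable P) x xs → count P? xs ≤ count P? (x ∷ xs)
count-∷ P? x xs with P? x
... | yes _ = n≤1+n _
... | no _  = ≤-refl

count-∷-yes : ∀ {A : Set} {P : Pred A 0ℓ} (P? : Decidable P) {x} xs → P x → suc (count P? xs) ≤ count P? (x ∷ xs)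
count-∷-yes P? {x} xs p with P? x
... | yes _ = ≤-refl
... | no ¬p = contradiction p ¬p

count-∪ : ∀ {A : Set} {P Q R : Pred A 0ℓ} (P? : Decidable P) (Q? : Decidable Q) (R? : Decidable R) {xs} →
          All (λ x → P x → Q x ⊎ R x) xs → count P? xs ≤ count Q? xs + count R? xs
count-∪ P? Q? R? [] = z≤n
count-∪ P? Q? R? {x ∷ xs} (cover ∷ covers) with P? x
... | no _ = ≤-trans (count-∪ P? Q? R? covers) (+-mono-≤ (count-∷ Q? x xs) (count-∷ R? x xs))
... | yes p with cover p
...   | inj₁ q = ≤-trans (s≤s (count-∪ P? Q? R? covers)) (+-mono-≤ (count-∷-yes Q? xs q) (count-∷ R? x xs))
...   | inj₂ r = ≤-trans (s≤s (count-∪ P? Q? R? covers))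
                   (≤-trans (≤-reflexive (sym (+-suc _ _))) (+-mono-≤ (count-∷ Q? x xs) (count-∷-yes R? xs r)))

count-map : ∀ {A B : Set} {P : Pred B 0ℓ} (P? : Decidable P) (f : A → B) xs → count (λ x → P? (f x)) xs ≡ count P? (map f xs)
count-map P? f [] = refl
count-map P? f (x ∷ xs) with P? (f x)
... | yes _ = cong suc (count-map P? f xs)
... | no _  = count-map P? f xs

-- Common in-neighbours and towers

InNeighbour : ∀ {k} → Digraph k → Fin k → Fin k → Fin k → Set
InNeighbour G x y z = Arc G z x × Arc G z y

HasCommon : ∀ {k} → Digraph k → List (Fin k) → Fin k → Fin k → Set
HasCommon G A x y = Any (InNeighbour G x y) A

hasCommon? : ∀ {k} (G : Digraph k) A x y → Dec (HasCommon G A x y)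
hasCommon? G A x y = Any.any? (λ z → T? (G z x) ×-dec T? (G z y)) A

-- There are `m + 1` nested levels, enough for heights 0 to `m`. Taking `x` equal to `y` is allowed,
-- so a vertex with a single out-neighbour is covered as well.
Tower : ∀ {k} → Digraph k → ℕ → List (Fin k) → Set
Tower G zero    A = ∃[ v ] v ∈ A
Tower G (suc m) A = ∃[ B ] ((∀ {x} → x ∈ B → x ∈ A) × Tower G m B × (∀ {x y} → x ∈ B → y ∈ B → HasCommon G A x y))

tower-nonempty : ∀ {k} (G : Digraph k) m {A} → Tower G m A → ∃[ v ] v ∈ A
tower-nonempty G zero    t = t
tower-nonempty G (suc m) (B , B⊆A , t , _) with v , v∈B ← tower-nonempty G m t = v , B⊆A v∈B

-- Every level can be `W` itself.
closed⇒tower : ∀ {k} (G : Digraph k) {W} → ∃[ v ] v ∈ W → (∀ {x y} → x ∈ W → y ∈ W → HasCommon G W x y) →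
               ∀ m → Tower G m W
closed⇒tower G ne com zero    = ne
closed⇒tower G ne com (suc m) = _ , id , closed⇒tower G ne com m , com

-- The first vertex dominates all later ones, so each level drops its head.
transitive⇒tower : ∀ {k} (G : Digraph k) m {xs} → AllPairs (Arc G) xs → m < length xs → Tower G m xs
transitive⇒tower G zero    {x ∷ xs} _ _ = x , here refl
transitive⇒tower G (suc m) {x ∷ xs} (a ∷ ap) (s≤s lt) =
  xs , there , transitive⇒tower G m ap lt , λ y∈ z∈ → here (All.lookup a y∈ , All.lookup a z∈)

-- Mapping a graph into a tower by height

Walk : ∀ {n} → Digraph n → ℕ → Fin n → Set
Walk H zero    u = ⊤
Walk H (suc m) u = ∃[ v ] (Arc H u v × Walk H m v)

walk? : ∀ {n} (H : Digraph n) m u → Dec (Walk H m u)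
walk? H zero    u = yes tt
walk? H (suc m) u = any? (λ v → T? (H u v) ×-dec walk? H m v)

outList : ∀ {n} → Digraph n → Fin n → List (Fin n)
outList {n} H u = filterᵇ (H u) (allFin n)

Arc⇒∈outList : ∀ {n} (H : Digraph n) {u v} → Arc H u v → v ∈ outList H u
Arc⇒∈outList H {u} {v} a = ∈-filter⁺ (T? ∘ H u) (∈-allFin v) a

-- The condition `¬ Walk H (suc m) u` says that `u` has height at most `m`. The induction keeps the
-- map into `B` on these vertices. The out-neighbours of a vertex of height `m + 1` already lie in
-- `B`, and there are at most two of them, so it can go to a common in-neighbour of their images in
-- `A`.
tower⇒hom : ∀ {n k} (H : Digraph n) (G : Digraph k) → (∀ u → outDeg H u ≤ 2) → ∀ m {A} → Tower G m A →
            Σ (Fin n → Fin k) λ f → (∀ u → ¬ Walk H (suc m) u → f u ∈ A) ×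
                                    (∀ u v → ¬ Walk H (suc m) u → Arc H u v → Arc G (f u) (f v))
-- A vertex of height 0 has no outgoing arc, so a constant map will do.
tower⇒hom {n} {k} H G deg zero (v , v∈A) =
  (λ _ → v) , (λ _ _ → v∈A) , λ u w ¬walk uw → contradiction (w , uw , tt) ¬walk
tower⇒hom {n} {k} H G deg (suc m) {A} t@(B , B⊆A , t′ , common) with tower⇒hom H G deg m t′
... | f , f∈B , f-hom = g , g∈A , g-hom
  where
  dominate : ∀ vs → length vs ≤ 2 → All (λ v → f v ∈ B) vs → ∃[ z ] (z ∈ A × All (λ v → Arc G z (f v)) vs)
  dominate [] _ _ with z , z∈A ← tower-nonempty G (suc m) t = z , z∈A , []
  dominate (x ∷ []) _ (x∈ ∷ _) with z , z∈A , zx , _ ← find (common x∈ x∈) = z , z∈A , zx ∷ []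
  dominate (x ∷ y ∷ []) _ (x∈ ∷ y∈ ∷ _) with z , z∈A , zx , zy ← find (common x∈ y∈) = z , z∈A , zx ∷ zy ∷ []
  dominate (_ ∷ _ ∷ _ ∷ _) (s≤s (s≤s ())) _

  next : ∀ u → ¬ Walk H (suc (suc m)) u → ∃[ z ] (z ∈ A × (∀ v → Arc H u v → Arc G z (f v)))
  next u ¬walk
    with z , z∈A , arcs ← dominate (outList H u) (deg u)
           (All.tabulate (λ {v} v∈ → f∈B v (λ w → ¬walk (v , proj₂ (∈-filter⁻ (T? ∘ H u) {xs = allFin _} v∈) , w))))
    = z , z∈A , λ v uv → All.lookup arcs (Arc⇒∈outList H uv)

  g : Fin n → Fin k
  g u with walk? H (suc m) u
  ... | no _ = f u
  ... | yes _ with walk? H (suc (suc m)) u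
  -- Vertices that are still too high get an arbitrary value.
  ...   | yes _ = f u
  ...   | no ¬w = proj₁ (next u ¬w)

  g∈A : ∀ u → ¬ Walk H (suc (suc m)) u → g u ∈ A
  g∈A u ¬walk with walk? H (suc m) u
  ... | no ¬w = B⊆A (f∈B u ¬w)
  ... | yes _ with walk? H (suc (suc m)) u
  ...   | yes w = contradiction w ¬walk
  ...   | no ¬w = proj₁ (proj₂ (next u ¬w))

  g≡f : ∀ v → ¬ Walk H (suc m) v → g v ≡ f v
  g≡f v ¬walk with walk? H (suc m) v
  ... | yes w = contradiction w ¬walk
  ... | no _ = refl

  g-hom : ∀ u v → ¬ Walk H (suc (suc m)) u → Arc H u v → Arc G (g u) (g v)
  -- The head of an arc is lower than its tail, so `v` has height at most `m` and its image has not
  -- changed.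
  g-hom u v ¬walk uv = subst (Arc G (g u)) (sym (g≡f v (λ w → ¬walk (v , uv , w)))) gu→fv
    where
    gu→fv : Arc G (g u) (f v)
    gu→fv with walk? H (suc m) u
    ... | no ¬w = f-hom u v ¬w uv
    ... | yes _ with walk? H (suc (suc m)) u
    ...   | yes w = contradiction w ¬walk
    ...   | no ¬w = proj₂ (proj₂ (next u ¬w)) v uv

-- Walks in acyclic graphs are paths

walkVertex : ∀ {n} (H : Digraph n) m {u} → Walk H m u → ℕ → Fin n
-- Beyond its end the walk stays at its last vertex, which lets positions be plain naturals.
walkVertex H zero    {u} _ _ = u
walkVertex H (suc m) {u} _ zero = u
walkVertex H (suc m) (v , _ , w) (suc i) = walkVertex H m w i

walkVertex-arc : ∀ {n} (H : Digraph n) m {u} (w : Walk H m u) i → i < m →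
                 Arc H (walkVertex H m w i) (walkVertex H m w (suc i))
walkVertex-arc H (suc zero)    (v , uv , w) zero    lt = uv
walkVertex-arc H (suc (suc m)) (v , uv , w) zero    lt = uv
walkVertex-arc H (suc m)       (v , uv , w) (suc i) lt = walkVertex-arc H m w i (s≤s⁻¹ lt)

-- By strong induction on d: a closed stretch of minimal length is an injective cycle.
acyclic⇒noRepeat : ∀ {n} (H : Digraph n) → IsAcyclic H → ∀ m (w : ℕ → Fin n) → (∀ i → i < m → Arc H (w i) (w (suc i))) →
                   ∀ d a → suc (a + d) ≤ m → w a ≢ w (suc (a + d))
acyclic⇒noRepeat H acyclic m w arc = <-rec _ step
  where
  step : ∀ d → (∀ {d′} → d′ < d → ∀ a → suc (a + d′) ≤ m → w a ≢ w (suc (a + d′))) →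
         ∀ a → suc (a + d) ≤ m → w a ≢ w (suc (a + d))
  step d ih a le closed = acyclic (d , (λ i → w (a + toℕ i)) , inj , arcs , last)
    where
    distinct : ∀ i j → i < j → j ≤ d → w (a + i) ≢ w (a + j)
    distinct i j i<j j≤d eq with e , refl ← m≤n⇒∃[o]m+o≡n i<j =
      ih (≤-trans (m≤n+m (suc e) i) (≤-trans (≤-reflexive (+-suc i e)) j≤d)) (a + i)
         (≤-trans (≤-reflexive (sym shape)) (≤-trans (+-monoʳ-≤ a j≤d) (≤-trans (n≤1+n _) le)))
         (≡-trans eq (cong w shape))
      where
      shape : a + (suc i + e) ≡ suc (a + i + e)
      shape = ≡-trans (+-suc a (i + e)) (cong suc (sym (+-assoc a i e)))
    inj : Injective _≡_ _≡_ (λ (i : Fin (suc d)) → w (a + toℕ i))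
    inj {i} {j} eq with <-cmp (toℕ i) (toℕ j)
    ... | tri< i<j _ _ = contradiction eq (distinct _ _ i<j (s≤s⁻¹ (toℕ<n j)))
    ... | tri≈ _ i≡j _ = toℕ-injective i≡j
    ... | tri> _ _ j<i = contradiction (sym eq) (distinct _ _ j<i (s≤s⁻¹ (toℕ<n i)))
    arcs : ∀ (i j : Fin (suc d)) → toℕ j ≡ suc (toℕ i) → Arc H (w (a + toℕ i)) (w (a + toℕ j))
    arcs i j eq = subst (Arc H (w (a + toℕ i)) ∘ w) (sym (≡-trans (cong (a +_) eq) (+-suc a (toℕ i))))
      (arc (a + toℕ i) (≤-trans (s≤s (+-monoʳ-≤ a (s≤s⁻¹ (toℕ<n i)))) le))
    last : ∀ (i : Fin (suc d)) → toℕ i ≡ d → Arc H (w (a + toℕ i)) (w (a + 0))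
    last i eq = subst (λ e → Arc H (w (a + e)) (w (a + 0))) (sym eq)
      (subst (Arc H (w (a + d))) (≡-trans (sym closed) (cong w (sym (+-identityʳ a)))) (arc (a + d) le))

-- A repeated vertex would close a cycle; `m` arcs without repetition visit `m + 1` vertices.
walk⇒dirPath : ∀ {n} (H : Digraph n) → IsAcyclic H → ∀ m {u} → Walk H m u → DirPath H (suc m)
walk⇒dirPath H acyclic m walk = (λ i → w (toℕ i)) , inj , arcs
  where
  w = walkVertex H m walk
  distinct : ∀ i j → i < j → j ≤ m → w i ≢ w j
  distinct i j i<j j≤m eq with e , refl ← m≤n⇒∃[o]m+o≡n i<j =
    acyclic⇒noRepeat H acyclic m w (walkVertex-arc H m walk) e i j≤m eq
  inj : Injective _≡_ _≡_ (λ (i : Fin (suc m)) → w (toℕ i))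
  inj {i} {j} eq with <-cmp (toℕ i) (toℕ j)
  ... | tri< i<j _ _ = contradiction eq (distinct _ _ i<j (s≤s⁻¹ (toℕ<n j)))
  ... | tri≈ _ i≡j _ = toℕ-injective i≡j
  ... | tri> _ _ j<i = contradiction (sym eq) (distinct _ _ j<i (s≤s⁻¹ (toℕ<n i)))
  arcs : ∀ (i j : Fin (suc m)) → toℕ j ≡ suc (toℕ i) → Arc H (w (toℕ i)) (w (toℕ j))
  arcs i j eq = subst (Arc H (w (toℕ i)) ∘ w) (sym eq)
    (walkVertex-arc H m walk (toℕ i) (s≤s⁻¹ (≤-trans (≤-reflexive (cong suc (sym eq))) (toℕ<n j))))

-- A walk with `m + 1` arcs would be a path on `m + 2` vertices. So every vertex has height at most
-- `m`, and the map into the tower respects all arcs.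
tower⇒τ : ∀ {n} (H : Digraph n) → IsAcyclic H → (∀ u → outDeg H u ≤ 2) → ∀ m → IsMaxPathSize H (suc m) →
          ∀ {k} (G : Digraph k) {A} → Tower G m A → ∃[ f ] IsHom H G f
tower⇒τ H acyclic deg m (_ , longest) G t with f , _ , hom ← tower⇒hom H G deg m t =
  f , λ u v uv → hom u v (λ w → 1+n≰n (longest _ (walk⇒dirPath H acyclic (suc m) w))) uv

-- Bad pairs and their matchings

module Pairs {k} (G : Digraph k) (isTournament : IsTournament G) where

  ¬arc⇒arc : ∀ {x y} → x ≢ y → ¬ Arc G x y → Arc G y x
  ¬arc⇒arc x≢y ¬xy = [ (λ xy → contradiction xy ¬xy) , id ]′ (proj₂ isTournament _ _ x≢y)

  Pair : Set
  Pair = Fin k × Fin k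

  neg : Pair → Pair
  neg (x , y) = y , x

  -- A pair represents its first component, and neg passes to the antipodal vertex.
  -- Two bad pairs always span a directed 4-cycle x → u → y → v → x, which is invariant under the quarter turn
  -- (P , Q) ↦ (Q , neg P); so the tournament on a family of bad pairs is an antipodal double cover.
  infix 4 _⟶_ _⇒_
  record _⟶_ (P Q : Pair) : Set where
    constructor cycle
    field
      arc₁ : Arc G (proj₁ P) (proj₁ Q)
      arc₂ : Arc G (proj₁ Q) (proj₂ P)
      arc₃ : Arc G (proj₂ P) (proj₂ Q)
      arc₄ : Arc G (proj₂ Q) (proj₁ P)
  open _⟶_ public

  _⟶?_ : Binary.Decidable _⟶_
  (x , y) ⟶? (u , v) with T? (G x u) ×-dec (T? (G u y) ×-dec (T? (G y v) ×-dec T? (G v x)))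
  ... | yes (a , b , c , d) = yes (cycle a b c d)
  ... | no ¬p = no λ { (cycle a b c d) → ¬p (a , b , c , d) }

  turn : ∀ {P Q} → P ⟶ Q → Q ⟶ neg P
  turn (cycle a b c d) = cycle b c d a

  turn⁻ : ∀ {P Q} → P ⟶ Q → neg Q ⟶ P
  turn⁻ (cycle a b c d) = cycle d a b c

  neg-⟶ : ∀ {P Q} → P ⟶ Q → neg P ⟶ neg Q
  neg-⟶ = turn ∘ turn

  Linked : Pair → Pair → Set
  Linked P Q = P ⟶ Q ⊎ Q ⟶ P

  linked-sym : ∀ {P Q} → Linked P Q → Linked Q P
  linked-sym = [ inj₂ , inj₁ ]′

  linked-negˡ : ∀ {P Q} → Linked P Q → Linked (neg P) Q
  linked-negˡ = [ inj₂ ∘ turn , inj₁ ∘ turn⁻ ]′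

  linked-negʳ : ∀ {P Q} → Linked P Q → Linked P (neg Q)
  linked-negʳ = linked-sym ∘ linked-negˡ ∘ linked-sym

  _⇒_ : List Pair → List Pair → Set
  X ⇒ Y = All (λ x → All (x ⟶_) Y) X

  _⇒?_ : Binary.Decidable _⇒_
  X ⇒? Y = All.all? (λ x → All.all? (x ⟶?_) Y) X

  ⇒-lookup : ∀ {X Y x y} → X ⇒ Y → x ∈ X → y ∈ Y → x ⟶ y
  ⇒-lookup XY x∈ y∈ = All.lookup (All.lookup XY x∈) y∈

  ⇒-negˡ : ∀ {X Y} → X ⇒ Y → Y ⇒ map neg X
  ⇒-negˡ XY = All.tabulate (λ y∈ → All.map⁺ (All.tabulate (λ x∈ → turn (⇒-lookup XY x∈ y∈))))

  ⇒-negʳ : ∀ {X Y} → X ⇒ Y → map neg Y ⇒ X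
  ⇒-negʳ XY = All.map⁺ (All.tabulate (λ y∈ → All.tabulate (λ x∈ → turn⁻ (⇒-lookup XY x∈ y∈))))

  Beside : List Pair → Pair → Set
  Beside Z w = All (_⟶ w) Z ⊎ All (w ⟶_) Z

  Bad : List (Fin k) → Pair → Set
  Bad A (x , y) = ¬ HasCommon G A x y

  -- One arc forces the other three. If `x` dominates `u`, it cannot dominate `v`, so `v` dominates
  -- `x`; then `v` cannot dominate `y`, so `y` dominates `v`, and hence not `u`. The opposite first
  -- arc gives the reverse cycle.
  bad⇒linked : ∀ {A x y u v} → x ∈ A → y ∈ A → u ∈ A → v ∈ A → Bad A (x , y) → Bad A (u , v) →
               x ≢ u → x ≢ v → y ≢ u → y ≢ v → Linked (x , y) (u , v)
  bad⇒linked {A} {x} {y} {u} {v} x∈ y∈ u∈ v∈ bxy buv x≢u x≢v y≢u y≢v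
    with proj₂ isTournament x u x≢u
  ... | inj₁ xu = inj₁ (cycle xu uy yv vx)
    where
    vx = ¬arc⇒arc x≢v (λ xv → buv (lose x∈ (xu , xv)))
    yv = ¬arc⇒arc (y≢v ∘ sym) (λ vy → bxy (lose v∈ (vx , vy)))
    uy = ¬arc⇒arc y≢u (λ yu → buv (lose y∈ (yu , yv)))
  ... | inj₂ ux = inj₂ (cycle ux xv vy yu)
    where
    yu = ¬arc⇒arc (y≢u ∘ sym) (λ uy → bxy (lose u∈ (ux , uy)))
    vy = ¬arc⇒arc y≢v (λ yv → buv (lose y∈ (yu , yv)))
    xv = ¬arc⇒arc (x≢v ∘ sym) (λ vx → bxy (lose v∈ (vx , vy)))

  Matching : ℕ → Set
  Matching t = ∃[ M ] (length M ≡ t × AllPairs Linked M)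

  MatchingIn : List (Fin k) → ℕ → List (Fin k) → Set
  MatchingIn A t B = ∃[ M ] (length M ≡ t × AllPairs Linked M × All (λ P → proj₁ P ∈ B × proj₂ P ∈ B × Bad A P) M)

  RemainderOf : List (Fin k) → ℕ → List (Fin k) → Set
  RemainderOf A t B =
    ∃[ B′ ] ((∀ {x} → x ∈ B′ → x ∈ A) × length B ≤ length B′ + 2 * t × Unique B′ × AllPairs (HasCommon G A) B′)

  -- Bad pairs are removed greedily, each costing two vertices. The pairs come from the shrinking
  -- list `B`, but badness always refers to `A`, which is what the next level of a tower needs.
  badMatching : ∀ A t B → (∀ {x} → x ∈ B → x ∈ A) → Unique B →
    MatchingIn A t B ⊎ RemainderOf A t B
  badMatching A zero B B⊆A uq = inj₁ ([] , refl , [] , [])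
  badMatching A (suc t) B B⊆A uq with findPair (λ x y → ¬? (hasCommon? G A x y)) B
  ... | inj₂ ap = inj₂ (B , B⊆A , m≤m+n _ _ , uq , AllPairs.map (decidable-stable (hasCommon? G A _ _)) ap)
  ... | inj₁ (x , y , zs , σ , bad) with AllPairs-resp-↭ (λ x≢y → x≢y ∘ sym) σ uq
  ...   | (x≢y ∷ x∉) ∷ y∉ ∷ uqz = go (badMatching A t zs (λ z∈ → B⊆A (zs⊆B z∈)) uqz)
    where
    zs⊆B : ∀ {z} → z ∈ zs → z ∈ B
    zs⊆B z∈ = ∈-resp-↭ (↭-sym σ) (there (there z∈))
    x∈B = ∈-resp-↭ (↭-sym σ) (here refl)
    y∈B = ∈-resp-↭ (↭-sym σ) (there (here refl))
    go : MatchingIn A t zs ⊎ RemainderOf A t zs →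
         MatchingIn A (suc t) B ⊎ RemainderOf A (suc t) B
    go (inj₁ (M , len , ap , pm)) = inj₁ ((x , y) ∷ M , cong suc len , All.map link pm ∷ ap ,
                                          (x∈B , y∈B , bad) ∷ All.map (λ (u∈ , v∈ , b) → zs⊆B u∈ , zs⊆B v∈ , b) pm)
      where
      link : ∀ {P} → proj₁ P ∈ zs × proj₂ P ∈ zs × Bad A P → Linked (x , y) P
      link (u∈ , v∈ , b) = bad⇒linked (B⊆A x∈B) (B⊆A y∈B) (B⊆A (zs⊆B u∈)) (B⊆A (zs⊆B v∈)) bad b
        (All.lookup x∉ u∈) (All.lookup x∉ v∈) (All.lookup y∉ u∈) (All.lookup y∉ v∈)
    go (inj₂ (B′ , B′⊆A , le , uq′ , ap)) = inj₂ (B′ , B′⊆A , le′ , uq′ , ap)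
      where
      open ≤-Reasoning
      le′ : length B ≤ length B′ + 2 * suc t
      le′ = begin
        length B                  ≡⟨ ↭-length σ ⟩
        2 + length zs             ≤⟨ +-monoʳ-≤ 2 le ⟩
        2 + (length B′ + 2 * t)   ≡⟨ rearrange (length B′) t ⟩
        length B′ + 2 * suc t     ∎
        where
        rearrange : ∀ b t → 2 + (b + 2 * t) ≡ b + 2 * suc t
        rearrange = solve-∀

  hasCommon-sym : ∀ {A x y} → HasCommon G A x y → HasCommon G A y x
  hasCommon-sym = Any.map (λ (zx , zy) → zy , zx)

  -- `AllPairs` does not compare a vertex with itself; a common in-neighbour with any second vertex
  -- of `B` settles that case.
  allPairs⇒all : ∀ {A B} → AllPairs (HasCommon G A) B → 2 ≤ length B → ∀ {x y} → x ∈ B → y ∈ B → HasCommon G A x y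
  allPairs⇒all ap le x∈ y∈ with AllPairs-lookup hasCommon-sym ap x∈ y∈
  ... | inj₂ c = c
  allPairs⇒all {B = a ∷ b ∷ _} ((c ∷ _) ∷ ap) le (here refl) y∈ | inj₁ refl = Any.map (λ (za , _) → za , za) c
  allPairs⇒all {B = a ∷ b ∷ _} (cs ∷ ap) le (there x∈) y∈ | inj₁ refl =
    Any.map (λ (_ , zx) → zx , zx) (All.lookup cs x∈)
  allPairs⇒all {B = a ∷ []} _ (s≤s ()) _ _ | inj₁ _

  -- Each of the `m` levels loses at most `2 * t` vertices; the extra 2 leaves the two vertices that
  -- `allPairs⇒all` asks for.
  tower⊎matching : ∀ t m A → Unique A → 2 * t * m + 2 ≤ length A → Tower G m A ⊎ Matching t
  tower⊎matching t zero (x ∷ A) uq le = inj₁ (x , here refl)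
  tower⊎matching t zero [] uq le with () ← ≤-trans (m≤n+m 2 (2 * t * 0)) le
  tower⊎matching t (suc m) A uq le with badMatching A t A id uq
  ... | inj₁ (M , len , ap , _) = inj₂ (M , len , ap)
  ... | inj₂ (B , B⊆A , leB , uqB , ap) =
    [ inj₁ ∘ extend , inj₂ ]′ (tower⊎matching t m B uqB big)
    where
    shape : ∀ t m → 2 * t * suc m + 2 ≡ 2 * t * m + 2 + 2 * t
    shape = solve-∀
    big : 2 * t * m + 2 ≤ length B
    big = +-cancelʳ-≤ (2 * t) _ _ (≤-trans (≤-reflexive (sym (shape t m))) (≤-trans le leB))
    extend : Tower G m B → Tower G (suc m) A
    extend T = B , B⊆A , T , allPairs⇒all ap (≤-trans (m≤n+m 2 (2 * t * m)) big)

-- Random switchings of a family of pairs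

module Switchings {k} (G : Digraph k) (isTournament : IsTournament G) where
  open Pairs G isTournament

  Hit : Pair → Pair → Pair → Set
  Hit P Q c = c ⟶ P × c ⟶ Q

  abstract
    hit? : ∀ P Q c → Dec (Hit P Q c)
    hit? P Q c = (c ⟶? P) ×-dec (c ⟶? Q)

  -- By `turn` and `turn⁻` the second alternative means `P ⟶ c` and `Q ⟶ c`. So `c` sees `P` and `Q`
  -- on the same side, and one of its two orientations hits both.
  Agree : Pair → Pair → Pair → Set
  Agree P Q c = Hit P Q c ⊎ Hit P Q (neg c)

  agree? : ∀ P Q c → Dec (Agree P Q c)
  agree? P Q c = hit? P Q c ⊎-dec hit? P Q (neg c)

  agreement : Pair → Pair → List Pair → ℕ
  agreement P Q = count (agree? P Q)

  Switching : List Pair → List Pair → Set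
  Switching = Pointwise (λ P P′ → P′ ≡ P ⊎ P′ ≡ neg P)

  -- The number of switchings of W in which no pair dominates both P and Q.
  misses : Pair → Pair → List Pair → ℕ
  misses P Q []      = 1
  misses P Q (c ∷ W) = (if does (hit? P Q c) then 0 else misses P Q W)
                     + (if does (hit? P Q (neg c)) then 0 else misses P Q W)

  -- Each pair on which `P` and `Q` agree at least halves the proportion of switchings that miss
  -- them.
  misses-bound : ∀ P Q W → misses P Q W * 2 ^ agreement P Q W ≤ 2 ^ length W
  misses-bound P Q [] = ≤-refl
  misses-bound P Q (c ∷ W) with hit? P Q c | hit? P Q (neg c) | misses-bound P Q W
  ... | yes _ | yes _ | _  = z≤n
  ... | yes _ | no _  | ih = ≤-trans (≤-reflexive (shape (misses P Q W) (2 ^ agreement P Q W))) (*-monoʳ-≤ 2 ih)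
    where
    shape : ∀ f a → f * (2 * a) ≡ 2 * (f * a)
    shape = solve-∀
  ... | no _  | yes _ | ih = ≤-trans (≤-reflexive (shape (misses P Q W) (2 ^ agreement P Q W))) (*-monoʳ-≤ 2 ih)
    where
    shape : ∀ f a → (f + 0) * (2 * a) ≡ 2 * (f * a)
    shape = solve-∀
  ... | no _  | no _  | ih = ≤-trans (≤-reflexive (shape (misses P Q W) (2 ^ agreement P Q W))) (*-monoʳ-≤ 2 ih)
    where
    shape : ∀ f a → (f + f) * a ≡ 2 * (f * a)
    shape = solve-∀

  totalMisses : List (Pair × Pair) → List Pair → ℕ
  totalMisses []            W = 0
  totalMisses ((P , Q) ∷ Φ) W = misses P Q W + totalMisses Φ W

  unhit : Pair → List (Pair × Pair) → List (Pair × Pair)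
  unhit c = filter (λ (P , Q) → ¬? (hit? P Q c))

  -- Once the orientation of `c` is fixed, only the requirements not hit by that choice can still be
  -- missed.
  totalMisses-split : ∀ c W Φ → totalMisses (unhit c Φ) W + totalMisses (unhit (neg c) Φ) W ≡ totalMisses Φ (c ∷ W)
  totalMisses-split c W [] = refl
  totalMisses-split c W ((P , Q) ∷ Φ) with hit? P Q c | hit? P Q (neg c)
  ... | yes _ | yes _ = totalMisses-split c W Φ
  ... | yes _ | no _  = ≡-trans (shape (totalMisses (unhit c Φ) W) (misses P Q W) _)
                          (cong (misses P Q W +_) (totalMisses-split c W Φ))
    where
    shape : ∀ a f b → a + (f + b) ≡ f + (a + b)
    shape = solve-∀
  ... | no _  | yes _ = ≡-trans (shape (misses P Q W) (totalMisses (unhit c Φ) W) _)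
                          (cong (misses P Q W + 0 +_) (totalMisses-split c W Φ))
    where
    shape : ∀ f a b → f + a + b ≡ f + 0 + (a + b)
    shape = solve-∀
  ... | no _  | no _  = ≡-trans (shape (misses P Q W) (totalMisses (unhit c Φ) W) _)
                          (cong (misses P Q W + misses P Q W +_) (totalMisses-split c W Φ))
    where
    shape : ∀ f a b → f + a + (f + b) ≡ f + f + (a + b)
    shape = solve-∀

  extendHitting : ∀ {c c′ W} Φ → c′ ≡ c ⊎ c′ ≡ neg c →
    ∃[ W′ ] (Switching W W′ × All (λ (P , Q) → Any (Hit P Q) W′) (unhit c′ Φ)) →
    ∃[ W′ ] (Switching (c ∷ W) W′ × All (λ (P , Q) → Any (Hit P Q) W′) Φ)
  extendHitting {c′ = c′} Φ sgn (W′ , sw , hits) = c′ ∷ W′ , sgn ∷ sw , All.tabulate hitBy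
    where
    hitBy : ∀ {PQ} → PQ ∈ Φ → Any (Hit (proj₁ PQ) (proj₂ PQ)) (c′ ∷ W′)
    hitBy {P , Q} PQ∈ with hit? P Q c′
    ... | yes h = here h
    ... | no ¬h = there (All.lookup hits (∈-filter⁺ (λ (P , Q) → ¬? (hit? P Q c′)) PQ∈ ¬h))

  -- This is the method of conditional expectations: the misses are shared between the two
  -- orientations of `c`, so one of them keeps the average number of misses per switching below 1.
  -- When no pair is left, this number counts the requirements still open, so there are none.
  hitting : ∀ W Φ → totalMisses Φ W < 2 ^ length W →
            ∃[ W′ ] (Switching W W′ × All (λ (P , Q) → Any (Hit P Q) W′) Φ)
  hitting [] []      _        = [] , [] , []
  hitting [] (_ ∷ _) (s≤s ())
  hitting (c ∷ W) Φ lt with totalMisses (unhit c Φ) W <? 2 ^ length W | totalMisses (unhit (neg c) Φ) W <? 2 ^ length W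
  ... | yes lt′ | _       = extendHitting Φ (inj₁ refl) (hitting W (unhit c Φ) lt′)
  ... | no _    | yes lt′ = extendHitting Φ (inj₂ refl) (hitting W (unhit (neg c) Φ) lt′)
  ... | no ¬lt₁ | no ¬lt₂ = contradiction lt (≤⇒≯ (begin
    2 * 2 ^ length W                                              ≡⟨ cong (2 ^ length W +_) (+-identityʳ _) ⟩
    2 ^ length W + 2 ^ length W                                   ≤⟨ +-mono-≤ (≮⇒≥ ¬lt₁) (≮⇒≥ ¬lt₂) ⟩
    totalMisses (unhit c Φ) W + totalMisses (unhit (neg c) Φ) W   ≡⟨ totalMisses-split c W Φ ⟩
    totalMisses Φ (c ∷ W)                                         ∎))
    where open ≤-Reasoning

  -- The union bound, multiplied out to avoid fractions.
  totalMisses-bound : ∀ L W Φ → All (λ (P , Q) → L < agreement P Q W) Φ →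
                      totalMisses Φ W * 2 ^ suc L ≤ length Φ * 2 ^ length W
  totalMisses-bound L W [] [] = z≤n
  totalMisses-bound L W ((P , Q) ∷ Φ) (far ∷ fars) = begin
    (misses P Q W + totalMisses Φ W) * 2 ^ suc L                ≡⟨ *-distribʳ-+ (2 ^ suc L) (misses P Q W) _ ⟩
    misses P Q W * 2 ^ suc L + totalMisses Φ W * 2 ^ suc L
      ≤⟨ +-mono-≤ (*-monoʳ-≤ (misses P Q W) (^-monoʳ-≤ 2 far)) (totalMisses-bound L W Φ fars) ⟩
    misses P Q W * 2 ^ agreement P Q W + length Φ * 2 ^ length W ≤⟨ +-monoˡ-≤ _ (misses-bound P Q W) ⟩
    2 ^ length W + length Φ * 2 ^ length W                      ∎
    where open ≤-Reasoning

  -- Both signs of `Q` are included so that the relation survives any switching; negating both pairs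
  -- does not lower the agreement.
  Far : ℕ → List Pair → Pair → Pair → Set
  Far L W P Q = L < agreement P Q W × L < agreement P (neg Q) W

  agree-neg : ∀ {P Q c} → Agree P Q c → Agree (neg P) (neg Q) c
  agree-neg (inj₁ (p , q)) = inj₂ (neg-⟶ p , neg-⟶ q)
  agree-neg (inj₂ (p , q)) = inj₁ (neg-⟶ p , neg-⟶ q)

  agreement-neg : ∀ P Q W → agreement P Q W ≤ agreement (neg P) (neg Q) W
  agreement-neg P Q = count-mono (agree? P Q) (agree? (neg P) (neg Q)) agree-neg

  far-negˡ : ∀ {L W P Q} → Far L W P Q → Far L W (neg P) Q
  far-negˡ {W = W} {P} {Q} (a , b) = <-≤-trans b (agreement-neg P (neg Q) W) , <-≤-trans a (agreement-neg P Q W)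

  far-negʳ : ∀ {L W P Q} → Far L W P Q → Far L W P (neg Q)
  far-negʳ (a , b) = b , a

  switch-allPairs : ∀ {R : Rel Pair 0ℓ} → (∀ {P Q} → R P Q → R (neg P) Q) → (∀ {P Q} → R P Q → R P (neg Q)) →
                    ∀ {W W′} → Switching W W′ → AllPairs R W → AllPairs R W′
  switch-allPairs nˡ nʳ [] [] = []
  switch-allPairs {R} nˡ nʳ (_∷_ {x = P} {xs = W} s sw) (r ∷ rs) = switchˡ s (switchʳ sw r) ∷ switch-allPairs nˡ nʳ sw rs
    where
    switchʳ : ∀ {V V′} → Switching V V′ → All (R P) V → All (R P) V′
    switchʳ [] [] = []
    switchʳ (inj₁ refl ∷ sw) (r ∷ rs) = r ∷ switchʳ sw rs
    switchʳ (inj₂ refl ∷ sw) (r ∷ rs) = nʳ r ∷ switchʳ sw rs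
    switchˡ : ∀ {P′ V} → P′ ≡ P ⊎ P′ ≡ neg P → All (R P) V → All (R P′) V
    switchˡ (inj₁ refl) rs = rs
    switchˡ (inj₂ refl) rs = All.map nˡ rs

  switch-⊆ : ∀ {W W′} → Switching W W′ → ∀ {P} → P ∈ W′ → P ∈ W ++ map neg W
  switch-⊆ {W} sw P∈ with go sw P∈
    where
    go : ∀ {W W′} → Switching W W′ → ∀ {P} → P ∈ W′ → P ∈ W ⊎ neg P ∈ W
    go (inj₁ refl ∷ sw) (here refl) = inj₁ (here refl)
    go (inj₂ refl ∷ sw) (here refl) = inj₂ (here refl)
    go (_ ∷ sw) (there P∈) = [ inj₁ ∘ there , inj₂ ∘ there ]′ (go sw P∈)
  ... | inj₁ P∈W = ∈-++⁺ˡ P∈W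
  ... | inj₂ negP∈W = ∈-++⁺ʳ W (∈-map⁺ neg negP∈W)

  length-cartesianProduct : ∀ {A B : Set} (xs : List A) (ys : List B) →
                            length (cartesianProduct xs ys) ≡ length xs * length ys
  length-cartesianProduct [] ys = refl
  length-cartesianProduct (x ∷ xs) ys =
    ≡-trans (length-++ (map (x ,_) ys)) (cong₂ _+_ (length-map (x ,_) ys) (length-cartesianProduct xs ys))

  -- The requirements must be fixed before the switching is known, so every sign pattern is listed.
  candidates : List Pair → List (Pair × Pair)
  candidates W = cartesianProduct (W ++ map neg W) (W ++ map neg W)

  agreementExceeds? : ∀ L W (PQ : Pair × Pair) → Dec (L < agreement (proj₁ PQ) (proj₂ PQ) W)
  agreementExceeds? L W (P , Q) = L <? agreement P Q W

  farRequirements : ℕ → List Pair → List (Pair × Pair)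
  farRequirements L W = filter (agreementExceeds? L W) (candidates W)

  length-farRequirements : ∀ L W → length (farRequirements L W) ≤ 4 * (length W * length W)
  length-farRequirements L W = begin
    length (farRequirements L W)                                        ≤⟨ length-filter (agreementExceeds? L W) (candidates W) ⟩
    length (cartesianProduct (W ++ map neg W) (W ++ map neg W))         ≡⟨ length-cartesianProduct (W ++ map neg W) _ ⟩
    length (W ++ map neg W) * length (W ++ map neg W)
      ≡⟨ cong (λ n → n * n) (≡-trans (length-++ W) (cong (length W +_) (length-map neg W))) ⟩
    (length W + length W) * (length W + length W)                       ≡⟨ shape (length W) ⟩
    4 * (length W * length W)                                           ∎
    where
    open ≤-Reasoning
    shape : ∀ n → (n + n) * (n + n) ≡ 4 * (n * n)
    shape = solve-∀

  -- Fewer than 2 ^ suc L requirements, each missed by at most a 2 ^ suc L-th of all switchings.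
  far⇒tower : ∀ L W m → 4 * (length W * length W) < 2 ^ suc L → 2 ≤ length W → AllPairs (Far L W) W →
              ∃[ A ] Tower G m A
  far⇒tower L W m few le far with hitting W (farRequirements L W) small
    where
    total = totalMisses (farRequirements L W) W
    open ≤-Reasoning
    small : total < 2 ^ length W
    small = *-cancelʳ-< (2 ^ suc L) total (2 ^ length W) (begin-strict
      total * 2 ^ suc L
        ≤⟨ totalMisses-bound L W (farRequirements L W) (All.all-filter (agreementExceeds? L W) (candidates W)) ⟩
      length (farRequirements L W) * 2 ^ length W     ≤⟨ *-monoˡ-≤ _ (length-farRequirements L W) ⟩
      4 * (length W * length W) * 2 ^ length W        <⟨ *-monoˡ-< (2 ^ length W) ⦃ m^n≢0 2 (length W) ⦄ few ⟩
      2 ^ suc L * 2 ^ length W                        ≡⟨ *-comm (2 ^ suc L) _ ⟩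
      2 ^ length W * 2 ^ suc L                        ∎)
  ... | W′ , sw , hits = map proj₁ W′ , closed⇒tower G nonempty (allPairs⇒all (AllPairs.map⁺ common) le′) m
    where
    le′ : 2 ≤ length (map proj₁ W′)
    le′ = ≤-trans le (≤-reflexive (≡-trans (Pointwise-length sw) (sym (length-map proj₁ W′))))
    nonempty : ∃[ v ] v ∈ map proj₁ W′
    nonempty with map proj₁ W′ | le′
    ... | v ∷ _ | _ = v , here refl
    far′ : AllPairs (Far L W) W′
    far′ = switch-allPairs {R = Far L W} (λ {P} {Q} → far-negˡ {L} {W} {P} {Q}) (λ {P} {Q} → far-negʳ {L} {W} {P} {Q}) sw far
    required : ∀ {P Q} → P ∈ W′ → Q ∈ W′ → Far L W P Q → HasCommon G (map proj₁ W′) (proj₁ P) (proj₁ Q)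
    required P∈ Q∈ (f , _) = hit⇒common (All.lookup hits (∈-filter⁺ (agreementExceeds? L W)
                               (∈-cartesianProduct⁺ (switch-⊆ sw P∈) (switch-⊆ sw Q∈)) f))
      where
      hit⇒common : ∀ {P Q} → Any (Hit P Q) W′ → HasCommon G (map proj₁ W′) (proj₁ P) (proj₁ Q)
      hit⇒common h with c , c∈ , cP , cQ ← find h = lose (∈-map⁺ proj₁ c∈) (arc₁ cP , arc₁ cQ)
    common : AllPairs (λ P Q → HasCommon G (map proj₁ W′) (proj₁ P) (proj₁ Q)) W′
    common = upgrade id far′
      where
      upgrade : ∀ {V} → (∀ {P} → P ∈ V → P ∈ W′) → AllPairs (Far L W) V →
                AllPairs (λ P Q → HasCommon G (map proj₁ W′) (proj₁ P) (proj₁ Q)) V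
      upgrade V⊆ [] = []
      upgrade V⊆ (f ∷ fs) = All.tabulate (λ Q∈ → required (V⊆ (here refl)) (V⊆ (there Q∈)) (All.lookup f Q∈))
                            ∷ upgrade (V⊆ ∘ there) fs

-- Merging near-twins into clusters

-- Merging stops at clusters of q pairs, which may fail to be homogeneous to at most θ other clusters.
module Clusters {k} (G : Digraph k) (isTournament : IsTournament G)
                (L q θ M m : ℕ) (0<θ : 0 < θ) (0<q : 0 < q) (q≤M : q ≤ M)
                (K : Pred (Fin k × Fin k) 0ℓ) (K-neg : ∀ {x y} → K (x , y) → K (y , x)) where
  open Pairs G isTournament
  open Switchings G isTournament

  -- The root stands for the whole cluster: near-twins are sought among roots only.
  record Cluster : Set where
    constructor cluster
    field
      root    : Pair
      members : List Pair
  open Cluster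

  Separated : Cluster → Cluster → Set
  Separated X Y = members X ⇒ members Y ⊎ members Y ⇒ members X

  abstract
    separated? : Binary.Decidable Separated
    separated? X Y = (members X ⇒? members Y) ⊎-dec (members Y ⇒? members X)

  separated-sym : ∀ {X Y} → Separated X Y → Separated Y X
  separated-sym = [ inj₂ , inj₁ ]′

  negCluster : Cluster → Cluster
  negCluster (cluster r X) = cluster (neg r) (map neg X)

  merge : Cluster → Cluster → Cluster
  merge (cluster r X) (cluster _ Y) = cluster r (X ++ Y)

  separated-neg : ∀ {X Y} → Separated X Y → Separated (negCluster X) Y
  separated-neg = [ inj₂ ∘ ⇒-negˡ , inj₁ ∘ ⇒-negʳ ]′

  Crossing : Cluster → Cluster → Set
  Crossing X Y = All (λ x → All (Linked x) (members Y)) (members X)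

  crossing-sym : ∀ {X Y} → Crossing X Y → Crossing Y X
  crossing-sym c = All.map (All.map linked-sym) (All.All-swap c)

  crossing-neg : ∀ {X Y} → Crossing X Y → Crossing (negCluster X) Y
  crossing-neg c = All.map⁺ (All.map (All.map linked-negˡ) c)

  -- The predicate `K` records a property that merging must preserve: it is trivial in the first
  -- round, and in the second it is homogeneity to the core already found. It is closed under `neg`
  -- because clusters may be replaced by their antipodes.
  record Sound (X : Cluster) : Set where
    constructor sound
    field
      root∈  : root X ∈ members X
      linked : AllPairs Linked (members X)
      all-K  : All K (members X)
  open Sound

  sound-neg : ∀ {X} → Sound X → Sound (negCluster X)
  sound-neg (sound r l a) =
    sound (∈-map⁺ neg r) (AllPairs.map⁺ (AllPairs.map (linked-negˡ ∘ linked-negʳ) l)) (All.map⁺ (All.map K-neg a))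

  sound-merge : ∀ {X Y} → Sound X → Sound Y → Crossing X Y → Sound (merge X Y)
  sound-merge (sound r l a) (sound _ l′ a′) c = sound (∈-++⁺ˡ r) (AllPairs.++⁺ l l′ c) (All.++⁺ a a′)

  -- If `Z` had `X` and `Y` on opposite sides, then `root X` and `neg (root Y)` would lie on the
  -- same side of `root Z`.
  merge-separated : ∀ {X Y Z} → Sound X → Sound Y → Sound Z → ¬ Agree (root X) (neg (root Y)) (root Z) →
                    Separated X Z → Separated Y Z → Separated (merge X Y) Z
  merge-separated sX sY sZ ¬agree (inj₁ XZ) (inj₁ YZ) = inj₁ (All.++⁺ XZ YZ)
  merge-separated sX sY sZ ¬agree (inj₂ ZX) (inj₂ ZY) =
    inj₂ (All.tabulate (λ z∈ → All.++⁺ (All.lookup ZX z∈) (All.lookup ZY z∈)))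
  merge-separated sX sY sZ ¬agree (inj₁ XZ) (inj₂ ZY) = contradiction
    (inj₂ (turn⁻ (⇒-lookup XZ (root∈ sX) (root∈ sZ)) , neg-⟶ (⇒-lookup ZY (root∈ sZ) (root∈ sY)))) ¬agree
  merge-separated sX sY sZ ¬agree (inj₂ ZX) (inj₁ YZ) = contradiction
    (inj₁ (⇒-lookup ZX (root∈ sZ) (root∈ sX) , turn (⇒-lookup YZ (root∈ sY) (root∈ sZ)))) ¬agree

  dirty? : ∀ X → Decidable (λ Y → ¬ Separated X Y)
  dirty? X Y = ¬? (separated? X Y)

  dirt : Cluster → List Cluster → ℕ
  dirt X = count (dirty? X)

  totalDirt : List Cluster → ℕ
  totalDirt []       = 0
  totalDirt (X ∷ As) = dirt X As + totalDirt As

  totalDirt-↭ : ∀ {As Bs} → As ↭ Bs → totalDirt As ≡ totalDirt Bs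
  totalDirt-↭ refl = refl
  totalDirt-↭ (prep X σ) = cong₂ _+_ (count-↭ (dirty? X) σ) (totalDirt-↭ σ)
  totalDirt-↭ (trans σ τ) = ≡-trans (totalDirt-↭ σ) (totalDirt-↭ τ)
  totalDirt-↭ (swap {As} {Bs} X Y σ)
    with separated? X Y | separated? Y X | count-↭ (dirty? X) σ | count-↭ (dirty? Y) σ | totalDirt-↭ σ
  ... | yes s | no ¬s | _ | _ | _ = contradiction (separated-sym {X} {Y} s) ¬s
  ... | no ¬s | yes s | _ | _ | _ = contradiction (separated-sym {Y} {X} s) ¬s
  ... | yes _ | yes _ | eqX | eqY | eq rewrite eqX | eqY | eq = shape (dirt X Bs) (dirt Y Bs) _
    where
    shape : ∀ a b c → a + (b + c) ≡ b + (a + c)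
    shape = solve-∀
  ... | no _  | no _  | eqX | eqY | eq rewrite eqX | eqY | eq = cong suc (shape (dirt X Bs) (dirt Y Bs) _)
    where
    shape : ∀ a b c → a + (b + c) ≡ b + (a + c)
    shape = solve-∀

  size : List Cluster → ℕ
  size []       = 0
  size (X ∷ As) = length (members X) + size As

  size-↭ : ∀ {As Bs} → As ↭ Bs → size As ≡ size Bs
  size-↭ refl = refl
  size-↭ (prep X σ) = cong (length (members X) +_) (size-↭ σ)
  size-↭ (trans σ τ) = ≡-trans (size-↭ σ) (size-↭ τ)
  size-↭ (swap {As} {Bs} X Y σ) rewrite size-↭ σ = shape (length (members X)) (length (members Y)) (size Bs)
    where
    shape : ∀ a b c → a + (b + c) ≡ b + (a + c)
    shape = solve-∀

  -- By `merge-separated`, new dirt arises only where the two roots behave differently, and the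
  -- agreement with `neg (root Y)` counts these places.
  dirt-merge : ∀ {X Y Zs} → Sound X → Sound Y → All Sound Zs →
               dirt (merge X Y) Zs ≤ dirt X Zs + (dirt Y Zs + agreement (root X) (neg (root Y)) (map root Zs))
  dirt-merge {X} {Y} {Zs} sX sY sZs = begin
    dirt (merge X Y) Zs
      ≤⟨ count-∪ (dirty? (merge X Y)) (dirty? X) rest? (All.map cover sZs) ⟩
    dirt X Zs + count rest? Zs
      ≤⟨ +-monoʳ-≤ (dirt X Zs) (count-∪ rest? (dirty? Y) agrees? (All.universal (λ _ → id) Zs)) ⟩
    dirt X Zs + (dirt Y Zs + count agrees? Zs)
      ≡⟨ cong (λ n → dirt X Zs + (dirt Y Zs + n)) (count-map (agree? (root X) (neg (root Y))) root Zs) ⟩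
    dirt X Zs + (dirt Y Zs + agreement (root X) (neg (root Y)) (map root Zs)) ∎
    where
    open ≤-Reasoning
    agrees? : Decidable (λ Z → Agree (root X) (neg (root Y)) (root Z))
    agrees? Z = agree? (root X) (neg (root Y)) (root Z)
    rest? : Decidable (λ Z → ¬ Separated Y Z ⊎ Agree (root X) (neg (root Y)) (root Z))
    rest? Z = dirty? Y Z ⊎-dec agrees? Z
    cover : ∀ {Z} → Sound Z → ¬ Separated (merge X Y) Z →
            ¬ Separated X Z ⊎ (¬ Separated Y Z ⊎ Agree (root X) (neg (root Y)) (root Z))
    cover {Z} sZ dirty with separated? X Z | separated? Y Z | agrees? Z
    ... | no ¬s | _     | _     = inj₁ ¬s
    ... | yes _ | no ¬s | _     = inj₂ (inj₁ ¬s)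
    ... | yes _ | yes _ | yes a = inj₂ (inj₂ a)
    ... | yes s | yes s′ | no ¬a = contradiction (merge-separated {X} {Y} {Z} sX sY sZ ¬a s s′) dirty

  dirt-neg : ∀ Y Zs → dirt (negCluster Y) Zs ≤ dirt Y Zs
  dirt-neg Y = count-mono (dirty? (negCluster Y)) (dirty? Y) (λ {Z} ¬s s → ¬s (separated-neg {Y} {Z} s))

  Small : Cluster → Set
  Small X = length (members X) < q

  -- Each cluster that is dropped has fewer than `q` members.
  size-separated : ∀ C {Zs} → All Small Zs → size Zs ≤ size (filter (separated? C) Zs) + dirt C Zs * q
  size-separated C [] = z≤n
  size-separated C {Z ∷ Zs} (small ∷ smalls) with separated? C Z
  ... | yes _ = ≤-trans (+-monoʳ-≤ (length (members Z)) (size-separated C smalls))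
                        (≤-reflexive (sym (+-assoc (length (members Z)) _ _)))
  ... | no _  = ≤-trans (+-mono-≤ (<⇒≤ small) (size-separated C smalls))
                        (≤-reflexive (shape q (size (filter (separated? C) Zs)) (dirt C Zs * q)))
    where
    shape : ∀ a b c → a + (b + c) ≡ b + (a + c)
    shape = solve-∀

  far? : ∀ W → Binary.Decidable (Far L W)
  far? W P Q = (L <? agreement P Q W) ×-dec (L <? agreement P (neg Q) W)

  record State (As : List Cluster) : Set where
    field
      sounds : All Sound As
      smalls : All Small As
      cross  : AllPairs Crossing As
  open State

  -- The new cluster `C` is kept apart from `state` because it may have reached `q` members.
  record Merged (As : List Cluster) : Set where
    field
      C         : Cluster
      Zs        : List Cluster
      sound-C   : Sound C
      size-C    : length (members C) ≤ 2 * q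
      cross-C   : All (Crossing C) Zs
      state     : State Zs
      size-≡    : length (members C) + size Zs ≡ size As
      length-≡  : suc (suc (length Zs)) ≡ length As
      dirt-≤    : dirt C Zs + totalDirt Zs ≤ totalDirt As + L

  -- The hypothesis says that root Y is a near-twin of root X among the other roots.
  mergeTwins : ∀ {As X Y′ Y Zs} → State As → As ↭ X ∷ Y′ ∷ Zs → (Y ≡ Y′ ⊎ Y ≡ negCluster Y′) →
               agreement (root X) (neg (root Y)) (map root As) ≤ L → Merged As
  mergeTwins {As} {X} {Y′} {Y} {Zs} st σ sgn le = record
    { C = merge X Y ; Zs = Zs
    ; sound-C = sound-merge {X} {Y} sX sY XY
    ; size-C = ≤-trans (≤-reflexive (length-++ (members X)))
        (+-mono-≤ (<⇒≤ small-X) (≤-trans (≤-reflexive sizeY) (≤-trans (<⇒≤ small-Y′) (m≤m+n q 0))))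
    ; cross-C = All.zipWith (λ (a , b) → All.++⁺ a b) (XZ , YZ)
    ; state = record { sounds = sZs ; smalls = smZs ; cross = crZs }
    ; size-≡ = size≡
    ; length-≡ = sym (↭-length σ)
    ; dirt-≤ = dirt≤
    }
    where
    open ≤-Reasoning
    perm-sounds = All-resp-↭ σ (sounds st)
    perm-smalls = All-resp-↭ σ (smalls st)
    perm-cross  = AllPairs-resp-↭ (λ {x} {y} → crossing-sym {x} {y}) σ (cross st)
    sX      = All.head perm-sounds
    sY′     = All.head (All.tail perm-sounds)
    sZs     = All.tail (All.tail perm-sounds)
    small-X  = All.head perm-smalls
    small-Y′ = All.head (All.tail perm-smalls)
    smZs    = All.tail (All.tail perm-smalls)
    XY′     = All.head (AllPairs.head perm-cross)
    XZ      = All.tail (AllPairs.head perm-cross)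
    Y′Z     = AllPairs.head (AllPairs.tail perm-cross)
    crZs    = AllPairs.tail (AllPairs.tail perm-cross)
    sY : Sound Y
    sY = [ (λ { refl → sY′ }) , (λ { refl → sound-neg {Y′} sY′ }) ]′ sgn
    XY : Crossing X Y
    XY = [ (λ { refl → XY′ })
         , (λ { refl → crossing-sym {Y} {X} (crossing-neg {Y′} {X} (crossing-sym {X} {Y′} XY′)) }) ]′ sgn
    YZ : All (Crossing Y) Zs
    YZ = [ (λ { refl → Y′Z }) , (λ { refl → All.map (λ {Z} → crossing-neg {Y′} {Z}) Y′Z }) ]′ sgn
    sizeY : length (members Y) ≡ length (members Y′)
    sizeY = [ (λ { refl → refl }) , (λ { refl → length-map neg (members Y′) }) ]′ sgn
    dirtY : dirt Y Zs ≤ dirt Y′ Zs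
    dirtY = [ (λ { refl → ≤-refl }) , (λ { refl → dirt-neg Y′ Zs }) ]′ sgn
    size≡ : length (members X ++ members Y) + size Zs ≡ size As
    size≡ = begin-equality
      length (members X ++ members Y) + size Zs                     ≡⟨ cong (_+ size Zs) (length-++ (members X)) ⟩
      length (members X) + length (members Y) + size Zs             ≡⟨ +-assoc (length (members X)) _ _ ⟩
      length (members X) + (length (members Y) + size Zs)           ≡⟨ cong (λ n → length (members X) + (n + size Zs)) sizeY ⟩
      length (members X) + (length (members Y′) + size Zs)          ≡⟨ size-↭ σ ⟨
      size As                                                       ∎
    errors : agreement (root X) (neg (root Y)) (map root Zs) ≤ L
    errors = begin
      agreement (root X) (neg (root Y)) (map root Zs)               ≤⟨ count-∷ ag? (root Y′) (map root Zs) ⟩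
      agreement (root X) (neg (root Y)) (map root (Y′ ∷ Zs))        ≤⟨ count-∷ ag? (root X) (map root (Y′ ∷ Zs)) ⟩
      agreement (root X) (neg (root Y)) (map root (X ∷ Y′ ∷ Zs))    ≡⟨ count-↭ ag? (map⁺ root σ) ⟨
      agreement (root X) (neg (root Y)) (map root As)               ≤⟨ le ⟩
      L                                                             ∎
      where ag? = agree? (root X) (neg (root Y))
    shape : ∀ a b l r → a + (b + l) + r ≡ a + (b + r) + l
    shape = solve-∀
    dirt≤ : dirt (merge X Y) Zs + totalDirt Zs ≤ totalDirt As + L
    dirt≤ = begin
      dirt (merge X Y) Zs + totalDirt Zs                            ≤⟨ +-monoˡ-≤ (totalDirt Zs) (dirt-merge {X} {Y} sX sY sZs) ⟩
      dirt X Zs + (dirt Y Zs + agreement (root X) (neg (root Y)) (map root Zs)) + totalDirt Zs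
                                                                    ≤⟨ +-monoˡ-≤ (totalDirt Zs) (+-monoʳ-≤ (dirt X Zs) (+-mono-≤ dirtY errors)) ⟩
      dirt X Zs + (dirt Y′ Zs + L) + totalDirt Zs                   ≡⟨ shape (dirt X Zs) (dirt Y′ Zs) L (totalDirt Zs) ⟩
      dirt X Zs + (dirt Y′ Zs + totalDirt Zs) + L                   ≤⟨ +-monoˡ-≤ L (+-monoˡ-≤ _ (count-∷ (dirty? X) Y′ Zs)) ⟩
      totalDirt (X ∷ Y′ ∷ Zs) + L                                   ≡⟨ cong (_+ L) (totalDirt-↭ σ) ⟨
      totalDirt As + L                                              ∎

  -- If all roots are pairwise far, a switching of the roots gives a tower. Otherwise one of the two
  -- agreement counts is at most `L`, so a merge is possible, perhaps after passing to the antipode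
  -- of `Y`.
  mergeStep : ∀ {As} → State As → 4 * (length As * length As) < 2 ^ suc L → 2 ≤ length As →
              (∃[ A ] Tower G m A) ⊎ Merged As
  mergeStep {As} st few le with findPair (λ X Y → ¬? (far? (map root As) (root X) (root Y))) As
  ... | inj₂ ap = inj₁ (far⇒tower L (map root As) m
          (subst (λ n → 4 * (n * n) < 2 ^ suc L) (sym (length-map root As)) few)
          (≤-trans le (≤-reflexive (sym (length-map root As))))
          (AllPairs.map⁺ (AllPairs.map (decidable-stable (far? (map root As) _ _)) ap)))
  ... | inj₁ (X , Y , Zs , σ , ¬far) with agreement (root X) (neg (root Y)) (map root As) ≤? L
  ...   | yes twins = inj₂ (mergeTwins {Y = Y} st σ (inj₁ refl) twins)
  ...   | no ¬twins with agreement (root X) (root Y) (map root As) ≤? L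
  ...     | yes antitwins = inj₂ (mergeTwins {Y = negCluster Y} st σ (inj₂ refl) antitwins)
  ...     | no ¬antitwins = contradiction (≰⇒> ¬antitwins , ≰⇒> ¬twins) ¬far

  -- The losses in `large-W` are the at most `2 * q` members of the cluster itself and the at most
  -- `θ` dirty clusters, each with fewer than `q` members.
  record Homogeneous : Set where
    field
      Z W       : List Pair
      large-Z   : q ≤ length Z
      linked-Z  : AllPairs Linked Z
      all-K-Z   : All K Z
      large-W   : M ≤ length W + (2 * q + θ * q)
      linked-W  : AllPairs Linked W
      all-K-W   : All K W
      beside    : All (Beside Z) W

  members⋆ : List Cluster → List Pair
  members⋆ = concat ∘ map members

  length-members⋆ : ∀ As → length (members⋆ As) ≡ size As
  length-members⋆ [] = refl
  length-members⋆ (X ∷ As) = ≡-trans (length-++ (members X)) (cong (length (members X) +_) (length-members⋆ As))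

  state-filter : ∀ {P : Pred Cluster 0ℓ} (P? : Decidable P) {As} → State As → State (filter P? As)
  state-filter P? st = record
    { sounds = All.filter⁺ P? (sounds st) ; smalls = All.filter⁺ P? (smalls st) ; cross = AllPairs.filter⁺ P? (cross st) }

  extract : ∀ {As} (mg : Merged As) → let open Merged mg in
            M ≤ size As → q ≤ length (members C) → dirt C Zs ≤ θ → Homogeneous
  extract {As} mg M≤ large clean = record
    { Z = members C ; W = members⋆ Ws ; large-Z = large ; linked-Z = linked sound-C ; all-K-Z = all-K sound-C
    ; large-W = bound
    ; linked-W = AllPairs.concat⁺ (All.map⁺ (All.map linked (sounds stW))) (AllPairs.map⁺ (cross stW))
    ; all-K-W = All.concat⁺ (All.map⁺ (All.map all-K (sounds stW)))
    ; beside = All.concat⁺ (All.map⁺ (All.map (λ {Y} → besideAll {Y}) (All.all-filter (separated? C) Zs)))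
    }
    where
    open Merged mg
    open ≤-Reasoning
    Ws = filter (separated? C) Zs
    stW = state-filter (separated? C) state
    besideAll : ∀ {Y} → Separated C Y → All (Beside (members C)) (members Y)
    besideAll (inj₁ CY) = All.tabulate (λ y∈ → inj₁ (All.tabulate (λ c∈ → ⇒-lookup CY c∈ y∈)))
    besideAll (inj₂ YC) = All.map inj₂ YC
    shape : ∀ a w b → a + (w + b) ≡ w + (a + b)
    shape = solve-∀
    bound : M ≤ length (members⋆ Ws) + (2 * q + θ * q)
    bound = begin
      M                                              ≤⟨ M≤ ⟩
      size As                                        ≡⟨ size-≡ ⟨
      length (members C) + size Zs                   ≤⟨ +-mono-≤ size-C (size-separated C (smalls state)) ⟩
      2 * q + (size Ws + dirt C Zs * q)              ≤⟨ +-monoʳ-≤ (2 * q) (+-monoʳ-≤ (size Ws) (*-monoˡ-≤ q clean)) ⟩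
      2 * q + (size Ws + θ * q)                      ≡⟨ shape (2 * q) (size Ws) (θ * q) ⟩
      size Ws + (2 * q + θ * q)                      ≡⟨ cong (_+ (2 * q + θ * q)) (length-members⋆ Ws) ⟨
      length (members⋆ Ws) + (2 * q + θ * q)         ∎

  -- Merging raises the total dirt by at most L and removes a cluster; discarding a cluster whose dirt exceeds θ
  -- costs at most 2 q members. This potential inequality survives both, and it fails when at most one cluster is left.
  Potential : List Cluster → Set
  Potential As = 2 * q * (totalDirt As + L * length As) + θ * M ≤ θ * size As

  potential⇒M≤size : ∀ {As} → Potential As → M ≤ size As
  potential⇒M≤size {As} pot =
    *-cancelˡ-≤ θ ⦃ >-nonZero 0<θ ⦄ (≤-trans (m≤n+m (θ * M) (2 * q * (totalDirt As + L * length As))) pot)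

  -- The list gets shorter by one, which frees exactly the `L` that the dirt may gain.
  potential-merge : ∀ {As} (mg : Merged As) → let open Merged mg in Potential As → Potential (C ∷ Zs)
  potential-merge {As} mg pot = begin
    2 * q * (dirt C Zs + totalDirt Zs + L * suc (length Zs)) + θ * M
      ≤⟨ +-monoˡ-≤ (θ * M) (*-monoʳ-≤ (2 * q) (+-monoˡ-≤ (L * suc (length Zs)) dirt-≤)) ⟩
    2 * q * (totalDirt As + L + L * suc (length Zs)) + θ * M
      ≡⟨ cong (λ n → 2 * q * n + θ * M) (≡-trans (shape (totalDirt As) L (length Zs)) (cong (λ n → totalDirt As + L * n) length-≡)) ⟩
    2 * q * (totalDirt As + L * length As) + θ * M
      ≤⟨ pot ⟩
    θ * size As
      ≡⟨ cong (θ *_) size-≡ ⟨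
    θ * (length (members C) + size Zs) ∎
    where
    open Merged mg
    open ≤-Reasoning
    shape : ∀ d l n → d + l + l * suc n ≡ d + l * suc (suc n)
    shape = solve-∀

  -- More than `θ` units of dirt disappear, each weighted `2 * q`, while the right-hand side drops
  -- by at most `θ * (2 * q)`.
  potential-discard : ∀ {C Zs} → length (members C) ≤ 2 * q → θ < dirt C Zs → Potential (C ∷ Zs) → Potential Zs
  potential-discard {C} {Zs} size-C dirty pot = +-cancelˡ-≤ (θ * (2 * q)) _ _ (begin
    θ * (2 * q) + (2 * q * (totalDirt Zs + L * length Zs) + θ * M)
      ≡⟨ shape θ (2 * q) (totalDirt Zs) (L * length Zs) (θ * M) ⟩
    2 * q * (θ + totalDirt Zs + L * length Zs) + θ * M
      ≤⟨ +-monoˡ-≤ (θ * M) (*-monoʳ-≤ (2 * q) (+-mono-≤ (+-monoˡ-≤ (totalDirt Zs) (<⇒≤ dirty)) (*-monoʳ-≤ L (n≤1+n (length Zs))))) ⟩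
    2 * q * (dirt C Zs + totalDirt Zs + L * suc (length Zs)) + θ * M
      ≤⟨ pot ⟩
    θ * (length (members C) + size Zs)
      ≡⟨ *-distribˡ-+ θ (length (members C)) (size Zs) ⟩
    θ * length (members C) + θ * size Zs
      ≤⟨ +-monoˡ-≤ (θ * size Zs) (*-monoʳ-≤ θ size-C) ⟩
    θ * (2 * q) + θ * size Zs ∎)
    where
    open ≤-Reasoning
    shape : ∀ t q d l m → t * q + (q * (d + l) + m) ≡ q * (t + d + l) + m
    shape = solve-∀

  ¬potential-[] : ¬ Potential []
  ¬potential-[] pot = <⇒≱ 0<q (≤-trans q≤M (potential⇒M≤size {[]} pot))

  ¬potential-[-] : ∀ {X} → Small X → ¬ Potential (X ∷ [])
  ¬potential-[-] {X} small pot =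
    <⇒≱ small (≤-trans q≤M (≤-trans (potential⇒M≤size {X ∷ []} pot) (≤-reflexive (+-identityʳ _))))

  -- A small merged cluster rejoins the list, a large clean one is the goal, and a large dirty one
  -- is discarded. The list shrinks every time, but by the potential it cannot fall to one cluster,
  -- so the process ends in one of the two outcomes.
  mergeDown : ∀ n As → length As ≤ n → 4 * (n * n) < 2 ^ suc L → State As → Potential As →
              (∃[ A ] Tower G m A) ⊎ Homogeneous
  mergeDown n [] _ _ st pot = contradiction pot ¬potential-[]
  mergeDown n (X ∷ []) _ _ st pot = contradiction pot (¬potential-[-] {X} (All.head (smalls st)))
  mergeDown (suc n) As@(_ ∷ _ ∷ _) le few st pot
    with mergeStep st (≤-<-trans (*-monoʳ-≤ 4 (*-mono-≤ le le)) few) (s≤s (s≤s z≤n))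
  ... | inj₁ tower = inj₁ tower
  ... | inj₂ mg with length (members (Merged.C mg)) <? q
  ...   | yes small = mergeDown n (C ∷ Zs) shorter few′ grown (potential-merge mg pot)
    where
    open Merged mg
    few′ = ≤-<-trans (*-monoʳ-≤ 4 (*-mono-≤ (n≤1+n n) (n≤1+n n))) few
    shorter : suc (length Zs) ≤ n
    shorter = s≤s⁻¹ (≤-trans (≤-reflexive length-≡) le)
    grown : State (C ∷ Zs)
    grown = record { sounds = sound-C ∷ sounds state ; smalls = small ∷ smalls state ; cross = cross-C ∷ cross state }
  ...   | no ¬small with dirt (Merged.C mg) (Merged.Zs mg) ≤? θ
  ...     | yes clean = inj₂ (extract mg (potential⇒M≤size {As} pot) (≮⇒≥ ¬small) clean)
  ...     | no ¬clean =
    mergeDown n Zs shorter few′ state (potential-discard {C} {Zs} size-C (≰⇒> ¬clean) (potential-merge mg pot))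
    where
    open Merged mg
    few′ = ≤-<-trans (*-monoʳ-≤ 4 (*-mono-≤ (n≤1+n n) (n≤1+n n))) few
    shorter : length Zs ≤ n
    shorter = ≤-trans (n≤1+n _) (s≤s⁻¹ (≤-trans (≤-reflexive length-≡) le))

  singletons : List Pair → List Cluster
  singletons = map (λ P → cluster P (P ∷ []))

  totalDirt-singletons : ∀ W → AllPairs Linked W → totalDirt (singletons W) ≡ 0
  totalDirt-singletons [] [] = refl
  totalDirt-singletons (P ∷ W) (l ∷ ls) = cong₂ _+_ (clean l) (totalDirt-singletons W ls)
    where
    clean : ∀ {V} → All (Linked P) V → dirt (cluster P (P ∷ [])) (singletons V) ≡ 0
    clean [] = refl
    clean (_∷_ {Q} l ls) with separated? (cluster P (P ∷ [])) (cluster Q (Q ∷ []))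
    ... | yes _ = clean ls
    ... | no ¬s = contradiction ([ (λ p → inj₁ ((p ∷ []) ∷ [])) , (λ p → inj₂ ((p ∷ []) ∷ [])) ]′ l) ¬s

  size-singletons : ∀ W → size (singletons W) ≡ length W
  size-singletons [] = refl
  size-singletons (P ∷ W) = cong suc (size-singletons W)

  -- Merging starts from singletons, which are free of dirt because linked pairs are separated.
  homogeneous : ∀ W → 1 < q → AllPairs Linked W → All K W → 4 * (length W * length W) < 2 ^ suc L →
                2 * q * (L * length W) + θ * M ≤ θ * length W → (∃[ A ] Tower G m A) ⊎ Homogeneous
  homogeneous W 1<q linked all-K few le = mergeDown (length W) (singletons W) (≤-reflexive length≡) few st pot
    where
    length≡ : length (singletons W) ≡ length W
    length≡ = length-map _ W
    st : State (singletons W)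
    st = record
      { sounds = All.map⁺ (All.map (λ k → sound (here refl) ([] ∷ []) (k ∷ [])) all-K)
      ; smalls = All.map⁺ (All.universal (λ _ → 1<q) W)
      ; cross  = AllPairs.map⁺ (AllPairs.map (λ l → (l ∷ []) ∷ []) linked) }
    pot : Potential (singletons W)
    pot rewrite totalDirt-singletons W linked | length≡ | size-singletons W = le

-- Cores and their lexicographic products

module Cores {k} (G : Digraph k) (isTournament : IsTournament G) where
  open Pairs G isTournament

  NoSource : List Pair → Set
  NoSource X = ∀ {x} → x ∈ X → ∃[ y ] (y ∈ X × y ⟶ x)

  -- A core abstracts the cyclic triangle: all that the product construction asks of a factor is an
  -- internal in-neighbour for each member.
  record Core : Set where
    constructor core
    field
      body     : List Pair
      nonempty : ∃[ x ] x ∈ body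
      noSource : NoSource body
  open Core public

  negCore : Core → Core
  negCore (core X (x , x∈) ns) = core (map neg X) (neg x , ∈-map⁺ neg x∈) noSource′
    where
    noSource′ : NoSource (map neg X)
    noSource′ x∈ with P , P∈ , refl ← ∈-map⁻ neg x∈ with y , y∈ , yP ← ns P∈ = neg y , ∈-map⁺ neg y∈ , neg-⟶ yP

  triangle : ∀ {x y z} → x ⟶ y → y ⟶ z → z ⟶ x → Core
  triangle {x} {y} {z} xy yz zx = core (x ∷ y ∷ z ∷ []) (x , here refl) λ where
    (here refl)                 → z , there (there (here refl)) , zx
    (there (here refl))         → x , here refl , xy
    (there (there (here refl))) → y , there (here refl) , yz

  _⊑_ : Core → List Pair → Set
  X ⊑ Z = ∀ {x} → x ∈ body X → x ∈ Z

  triangle-⊑ : ∀ {x y z Z} (xy : x ⟶ y) (yz : y ⟶ z) (zx : z ⟶ x) → x ∈ Z → y ∈ Z → z ∈ Z → triangle xy yz zx ⊑ Z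
  triangle-⊑ _ _ _ x∈ y∈ z∈ (here refl)                 = x∈
  triangle-⊑ _ _ _ x∈ y∈ z∈ (there (here refl))         = y∈
  triangle-⊑ _ _ _ x∈ y∈ z∈ (there (there (here refl))) = z∈

  allOrAny : ∀ {A : Set} {P Q : Pred A 0ℓ} {xs} → All (λ x → P x ⊎ Q x) xs → All P xs ⊎ Any Q xs
  allOrAny [] = inj₁ []
  allOrAny (inj₂ q ∷ _) = inj₂ (here q)
  allOrAny (inj₁ p ∷ r) = [ (λ ps → inj₁ (p ∷ ps)) , inj₂ ∘ there ]′ (allOrAny r)

  -- An insertion sort step. It fails only if `x` precedes `z` while a later `w` precedes `x`, and
  -- then `x`, `z`, `w` form a cyclic triangle.
  insert : ∀ x {Z} → AllPairs _⟶_ Z → All (Linked x) Z →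
           (∃[ X ] X ⊑ (x ∷ Z)) ⊎ (∃[ Z′ ] (x ∷ Z ↭ Z′ × AllPairs _⟶_ Z′))
  insert x [] [] = inj₂ (x ∷ [] , refl , [] ∷ [])
  insert x {z ∷ Z} (zZ ∷ ap) (inj₁ xz ∷ ls) with allOrAny ls
  ... | inj₁ xZ = inj₂ (x ∷ z ∷ Z , refl , (xz ∷ xZ) ∷ zZ ∷ ap)
  ... | inj₂ back with w , w∈ , wx ← find back =
    inj₁ (triangle xz (All.lookup zZ w∈) wx ,
          triangle-⊑ xz (All.lookup zZ w∈) wx (here refl) (there (here refl)) (there (there w∈)))
  insert x {z ∷ Z} (zZ ∷ ap) (inj₂ zx ∷ ls) with insert x ap ls
  ... | inj₁ (X , X⊑) = inj₁ (X , λ y∈ → widen (X⊑ y∈))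
    where
    widen : ∀ {y} → y ∈ x ∷ Z → y ∈ x ∷ z ∷ Z
    widen (here eq)  = here eq
    widen (there y∈) = there (there y∈)
  ... | inj₂ (Z′ , σ , ap′) = inj₂ (z ∷ Z′ , trans (swap x z refl) (prep z σ) , All-resp-↭ σ (zx ∷ zZ) ∷ ap′)

  coreOrTransitive : ∀ {Z} → AllPairs Linked Z → (∃[ X ] X ⊑ Z) ⊎ (∃[ Z′ ] (Z ↭ Z′ × AllPairs _⟶_ Z′))
  coreOrTransitive [] = inj₂ ([] , refl , [])
  coreOrTransitive {x ∷ Z} (l ∷ ls) with coreOrTransitive ls
  ... | inj₁ (X , X⊑) = inj₁ (X , λ y∈ → there (X⊑ y∈))
  ... | inj₂ (Z′ , σ , ap) with insert x ap (All-resp-↭ σ l)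
  ...   | inj₁ (X , X⊑) = inj₁ (X , λ y∈ → ∈-resp-↭ (prep x (↭-sym σ)) (X⊑ y∈))
  ...   | inj₂ (Z″ , τ , ap′) = inj₂ (Z″ , trans (prep x σ) τ , ap′)

  coreOrTower : ∀ m {Z} → AllPairs Linked Z → m < length Z → (∃[ A ] Tower G m A) ⊎ (∃[ X ] X ⊑ Z)
  coreOrTower m ls lt with coreOrTransitive ls
  ... | inj₁ X = inj₂ X
  ... | inj₂ (Z′ , σ , ap) = inj₁ (map proj₁ Z′ , transitive⇒tower G m (AllPairs.map⁺ (AllPairs.map arc₁ ap))
          (≤-trans lt (≤-reflexive (≡-trans (↭-length σ) (sym (length-map proj₁ Z′))))))

  Homog : List Pair → List Pair → Set
  Homog X Y = X ⇒ Y ⊎ Y ⇒ X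

  homog-sym : ∀ {X Y} → Homog X Y → Homog Y X
  homog-sym = [ inj₂ , inj₁ ]′

  homog-negˡ : ∀ {X Y} → Homog X Y → Homog (map neg X) Y
  homog-negˡ = [ inj₂ ∘ ⇒-negˡ , inj₁ ∘ ⇒-negʳ ]′

  homog-negʳ : ∀ {X Y} → Homog X Y → Homog X (map neg Y)
  homog-negʳ {X} {Y} h = homog-sym {map neg Y} (homog-negˡ (homog-sym {X} {Y} h))

  homog-⊆ : ∀ {X Y X′ Y′} → (∀ {x} → x ∈ X′ → x ∈ X) → (∀ {y} → y ∈ Y′ → y ∈ Y) → Homog X Y → Homog X′ Y′
  homog-⊆ X′⊆ Y′⊆ (inj₁ XY) = inj₁ (All.tabulate (λ x∈ → All.tabulate (λ y∈ → ⇒-lookup XY (X′⊆ x∈) (Y′⊆ y∈))))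
  homog-⊆ X′⊆ Y′⊆ (inj₂ YX) = inj₂ (All.tabulate (λ y∈ → All.tabulate (λ x∈ → ⇒-lookup YX (Y′⊆ y∈) (X′⊆ x∈))))

  -- Two members of one core are dominated by any member of the preceding core. For members of
  -- consecutive cores, an in-neighbour of the first inside its own core also dominates the second.
  cyclicCores⇒tower : ∀ m X Y Z → body X ⇒ body Y → body Y ⇒ body Z → body Z ⇒ body X → ∃[ A ] Tower G m A
  cyclicCores⇒tower m X Y Z XY YZ ZX = map proj₁ W , closed⇒tower G (proj₁ x₀ , ∈-map⁺ proj₁ (∈X x₀∈)) common m
    where
    W = body X ++ body Y ++ body Z
    ∈X : ∀ {P} → P ∈ body X → P ∈ W
    ∈X = ∈-++⁺ˡ
    ∈Y : ∀ {P} → P ∈ body Y → P ∈ W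
    ∈Y = ∈-++⁺ʳ (body X) ∘ ∈-++⁺ˡ
    ∈Z : ∀ {P} → P ∈ body Z → P ∈ W
    ∈Z = ∈-++⁺ʳ (body X) ∘ ∈-++⁺ʳ (body Y)
    x₀ = proj₁ (nonempty X)
    x₀∈ = proj₂ (nonempty X)

    Dominated : Pair → Pair → Set
    Dominated P Q = ∃[ c ] (c ∈ W × c ⟶ P × c ⟶ Q)

    flip : ∀ {P Q} → Dominated P Q → Dominated Q P
    flip (c , c∈ , cP , cQ) = c , c∈ , cQ , cP

    within : ∀ U V → body U ⇒ body V → (∀ {P} → P ∈ body U → P ∈ W) → ∀ {P Q} → P ∈ body V → Q ∈ body V → Dominated P Q
    within U V UV ⊆W P∈ Q∈ with c , c∈ ← nonempty U = c , ⊆W c∈ , ⇒-lookup UV c∈ P∈ , ⇒-lookup UV c∈ Q∈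

    across : ∀ U V → body U ⇒ body V → (∀ {P} → P ∈ body U → P ∈ W) → ∀ {P Q} → P ∈ body U → Q ∈ body V → Dominated P Q
    across U V UV ⊆W P∈ Q∈ with c , c∈ , cP ← noSource U P∈ = c , ⊆W c∈ , cP , ⇒-lookup UV c∈ Q∈

    split : ∀ {P} → P ∈ W → P ∈ body X ⊎ (P ∈ body Y ⊎ P ∈ body Z)
    split P∈ = [ inj₁ , inj₂ ∘ ∈-++⁻ (body Y) ]′ (∈-++⁻ (body X) P∈)

    dominated : ∀ {P Q} → P ∈ W → Q ∈ W → Dominated P Q
    dominated P∈ Q∈ with split P∈ | split Q∈
    ... | inj₁ p        | inj₁ q        = within Z X ZX ∈Z p q
    ... | inj₁ p        | inj₂ (inj₁ q) = across X Y XY ∈X p q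
    ... | inj₁ p        | inj₂ (inj₂ q) = flip (across Z X ZX ∈Z q p)
    ... | inj₂ (inj₁ p) | inj₁ q        = flip (across X Y XY ∈X q p)
    ... | inj₂ (inj₁ p) | inj₂ (inj₁ q) = within X Y XY ∈X p q
    ... | inj₂ (inj₁ p) | inj₂ (inj₂ q) = across Y Z YZ ∈Y p q
    ... | inj₂ (inj₂ p) | inj₁ q        = across Z X ZX ∈Z p q
    ... | inj₂ (inj₂ p) | inj₂ (inj₁ q) = flip (across Y Z YZ ∈Y q p)
    ... | inj₂ (inj₂ p) | inj₂ (inj₂ q) = within Y Z YZ ∈Y p q

    common : ∀ {x y} → x ∈ map proj₁ W → y ∈ map proj₁ W → HasCommon G (map proj₁ W) x y
    common x∈ y∈ with P , P∈ , refl ← ∈-map⁻ proj₁ x∈ | Q , Q∈ , refl ← ∈-map⁻ proj₁ y∈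
      with c , c∈ , cP , cQ ← dominated P∈ Q∈ = lose (∈-map⁺ proj₁ c∈) (arc₁ cP , arc₁ cQ)

  -- If the three cores are ordered transitively, the antipode of the middle one closes the cycle
  -- `X`, `Z`, `negCore Y`.
  pathCores⇒tower : ∀ m X Y Z → body X ⇒ body Y → body Y ⇒ body Z → Homog (body X) (body Z) → ∃[ A ] Tower G m A
  pathCores⇒tower m X Y Z XY YZ (inj₁ XZ) = cyclicCores⇒tower m X Z (negCore Y) XZ (⇒-negˡ YZ) (⇒-negʳ XY)
  pathCores⇒tower m X Y Z XY YZ (inj₂ ZX) = cyclicCores⇒tower m X Y Z XY YZ ZX

  -- Passing to an antipode reverses the direction between two homogeneous cores, so `X`, `Y`, `Z`
  -- can be straightened into a path.
  homogCores⇒tower : ∀ m X Y Z → Homog (body X) (body Y) → Homog (body Y) (body Z) → Homog (body X) (body Z) →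
                     ∃[ A ] Tower G m A
  homogCores⇒tower m X Y Z (inj₁ XY) (inj₁ YZ) XZ = pathCores⇒tower m X Y Z XY YZ XZ
  homogCores⇒tower m X Y Z (inj₁ XY) (inj₂ ZY) XZ =
    pathCores⇒tower m X Y (negCore Z) XY (⇒-negˡ ZY) (homog-negʳ {body X} XZ)
  homogCores⇒tower m X Y Z (inj₂ YX) (inj₁ YZ) XZ =
    pathCores⇒tower m X (negCore Y) (negCore Z) (⇒-negˡ YX) (⇒-negˡ (⇒-negˡ YZ)) (homog-negʳ {body X} XZ)
  homogCores⇒tower m X Y Z (inj₂ YX) (inj₂ ZY) XZ =
    pathCores⇒tower m X (negCore Y) Z (⇒-negˡ YX) (⇒-negʳ ZY) XZ

-- Finding three mutually homogeneous cores

halve : ∀ {A : Set} {R : Rel A 0ℓ} {P Q : Pred A 0ℓ} n {xs} → n + n ≤ length xs →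
        All (λ x → P x ⊎ Q x) xs → AllPairs R xs →
        ∃[ ys ] (n ≤ length ys × AllPairs R ys × (∀ {x} → x ∈ ys → x ∈ xs) × (All P ys ⊎ All Q ys))
halve n le pqs rs with ys , zs , len , (ps , rys , ys⊆) , (qs , rzs , zs⊆) ← partitionAll pqs rs | n ≤? length ys
... | yes n≤ys = ys , n≤ys , rys , ys⊆ , inj₁ ps
... | no n≰ys =
  zs , +-cancelˡ-≤ n _ _ (≤-trans le (≤-trans (≤-reflexive (sym len)) (+-monoˡ-≤ (length zs) (<⇒≤ (≰⇒> n≰ys))))) ,
  rzs , zs⊆ , inj₂ qs

module ThreeCores {k} (G : Digraph k) (isTournament : IsTournament G)
                  (m L q : ℕ) (0<L : 0 < L) (2p≤q : suc m + suc m ≤ q) where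
  open Pairs G isTournament
  open Cores G isTournament

  -- The sizes are computed backwards. A round of merging turns `2 * M` pairs into at least `M`
  -- minus the loss `e`; the second round must leave `2 * q` pairs and the first `2 * M₂`. With `θ`
  -- equal to `4 * q * L` the potential inequality starts as an equality. For `q` and `L` linear in
  -- the path size, `t` is cubic.
  θ e M₂ M₁ t : ℕ
  θ = 4 * q * L
  e = 2 * q + θ * q
  M₂ = 2 * q + e
  M₁ = 2 * M₂ + e
  t = 2 * M₁

  Towered : Set
  Towered = ∃[ A ] Tower G m A

  p≤q : suc m ≤ q
  p≤q = m+n≤o⇒m≤o (suc m) 2p≤q

  1<q : 1 < q
  1<q = ≤-trans (+-mono-≤ {1} {suc m} {1} {suc m} (s≤s z≤n) (s≤s z≤n)) 2p≤q

  0<θ : 0 < θ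
  0<θ = *-mono-< {0} {4 * q} (≤-trans (<⇒≤ 1<q) (m≤m+n q _)) 0<L

  potential : ∀ M → 2 * q * (L * (2 * M)) + θ * M ≤ θ * (2 * M)
  potential M = ≤-reflexive (shape q L M)
    where
    shape : ∀ q l M → 2 * q * (l * (2 * M)) + 4 * q * l * M ≡ 4 * q * l * (2 * M)
    shape = solve-∀

  beside-neg : ∀ X {x y} → Beside X (x , y) → Beside X (y , x)
  beside-neg X = [ inj₂ ∘ All.map turn⁻ , inj₁ ∘ All.map turn ]′

  homog-halve : ∀ X n {Y} → n + n ≤ length Y → AllPairs Linked Y → All (Beside X) Y →
                ∃[ Y′ ] (n ≤ length Y′ × AllPairs Linked Y′ × (∀ {y} → y ∈ Y′ → y ∈ Y) × Homog X Y′)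
  homog-halve X n le ls bs with Y′ , n≤ , ls′ , Y′⊆ , side ← halve n le bs ls =
    Y′ , n≤ , ls′ , Y′⊆ , [ inj₁ ∘ All.All-swap , inj₂ ]′ side

  beside-⊑ : ∀ {X Z w} → X ⊑ Z → Beside Z w → Beside (body X) w
  beside-⊑ X⊑ = [ (λ b → inj₁ (All.tabulate (All.lookup b ∘ X⊑))) , (λ b → inj₂ (All.tabulate (All.lookup b ∘ X⊑))) ]′

  -- Halving by the side of `X₁` leaves `q` pairs, and halving again by the side of `X₂` leaves
  -- `suc m`, enough for a third core or a transitive tower.
  twoCores⇒tower : ∀ X₁ X₂ {W} → Homog (body X₁) (body X₂) → 2 * q ≤ length W → AllPairs Linked W →
              All (Beside (body X₁)) W → All (Beside (body X₂)) W → Towered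
  twoCores⇒tower X₁ X₂ {W} X₁X₂ le ls b₁ b₂
    with V , leV , lsV , V⊆ , X₁V ← homog-halve (body X₁) q (subst (_≤ length W) (cong (q +_) (+-identityʳ q)) le) ls b₁
    with U , leU , lsU , U⊆ , X₂U ← homog-halve (body X₂) (suc m) (≤-trans 2p≤q leV) lsV (All.tabulate (All.lookup b₂ ∘ V⊆))
    with coreOrTower m lsU leU
  ... | inj₁ tower = tower
  ... | inj₂ (X₃ , X₃⊑) =
    homogCores⇒tower m X₁ X₂ X₃ X₁X₂ (homog-⊆ {body X₂} id X₃⊑ X₂U) (homog-⊆ {body X₁} id (U⊆ ∘ X₃⊑) X₁V)

  -- In this second round `K` keeps every pair beside `X₁`. Half of the new cluster lies on one side
  -- of `X₁`, so a core found there is homogeneous to `X₁`.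
  oneCore⇒tower : ∀ X₁ {W} → length W ≡ 2 * M₂ → 4 * (2 * M₂ * (2 * M₂)) < 2 ^ suc L → AllPairs Linked W →
               All (Beside (body X₁)) W → Towered
  oneCore⇒tower X₁ {W} len few ls bs
    with Clusters.homogeneous G isTournament L q θ M₂ m 0<θ (<⇒≤ 1<q) (≤-trans (m≤m+n q (q + 0)) (m≤m+n (2 * q) e))
           (Beside (body X₁)) (beside-neg (body X₁)) W 1<q ls bs
           (subst (λ n → 4 * (n * n) < 2 ^ suc L) (sym len) few)
           (subst (λ n → 2 * q * (L * n) + θ * M₂ ≤ θ * n) (sym len) (potential M₂))
  ... | inj₁ tower = tower
  ... | inj₂ h = go
    where
    open Clusters.Homogeneous h renaming (W to V)
    leV : 2 * q ≤ length V
    leV = +-cancelʳ-≤ e _ _ large-W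
    go : Towered
    go with Y , leY , lsY , Y⊆ , X₁Y ← homog-halve (body X₁) (suc m) (≤-trans 2p≤q large-Z) linked-Z all-K-Z
       with coreOrTower m lsY leY
    ... | inj₁ tower = tower
    ... | inj₂ (X₂ , X₂⊑) = twoCores⇒tower X₁ X₂ (homog-⊆ {body X₁} id X₂⊑ X₁Y) leV linked-W all-K-W
                              (All.map (beside-⊑ {X₂} (Y⊆ ∘ X₂⊑)) beside)

  matching⇒tower : 4 * (t * t) < 2 ^ suc L → Matching t → Towered
  matching⇒tower few (W , len , ls)
    with Clusters.homogeneous G isTournament L q θ M₁ m 0<θ (<⇒≤ 1<q) q≤M₁ (λ _ → ⊤) _ W 1<q ls (All.universal (λ _ → tt) W)
           (subst (λ n → 4 * (n * n) < 2 ^ suc L) (sym len) few)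
           (subst (λ n → 2 * q * (L * n) + θ * M₁ ≤ θ * n) (sym len) (potential M₁))
    where
    q≤M₁ : q ≤ M₁
    q≤M₁ = ≤-trans (m≤m+n q (q + 0)) (≤-trans (m≤m+n (2 * q) e) (≤-trans (m≤m+n M₂ (M₂ + 0)) (m≤m+n (2 * M₂) e)))
  ... | inj₁ tower = tower
  ... | inj₂ h = go
    where
    open Clusters.Homogeneous h renaming (W to V)
    leV : 2 * M₂ ≤ length V
    leV = +-cancelʳ-≤ e _ _ large-W
    2M₂≤t : 2 * M₂ ≤ t
    2M₂≤t = ≤-trans (m≤m+n (2 * M₂) e) (m≤m+n M₁ (M₁ + 0))
    go : Towered
    go with coreOrTower m linked-Z (≤-trans p≤q large-Z)
    ... | inj₁ tower = tower
    -- Cutting down to exactly `2 * M₂` pairs gives the length for which the second round was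
    -- calibrated.
    ... | inj₂ (X₁ , X₁⊑) = oneCore⇒tower X₁ {take (2 * M₂) V} (≡-trans (length-take (2 * M₂) V) (m≤n⇒m⊓n≡m leV))
            (≤-<-trans (*-monoʳ-≤ 4 (*-mono-≤ 2M₂≤t 2M₂≤t)) few)
            (AllPairs.take⁺ (2 * M₂) linked-W)
            (All.take⁺ (2 * M₂) (All.map (beside-⊑ {X₁} X₁⊑) beside))

  tournament⇒tower : 4 * (t * t) < 2 ^ suc L → 2 * t * m + 2 ≤ k → Towered
  tournament⇒tower few le
    with tower⊎matching t m (allFin k) (allFin⁺ k) (≤-trans le (≤-reflexive (sym (length-tabulate {n = k} id))))
  ... | inj₁ T = allFin k , T
  ... | inj₂ M = matching⇒tower few M

-- Choice of constants

n<2^n : ∀ n → n < 2 ^ n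
n<2^n zero    = s≤s z≤n
n<2^n (suc n) = ≤-trans (≤-reflexive (+-comm 1 (suc n)))
  (+-mono-≤ (n<2^n n) (≤-trans (≤-trans (s≤s z≤n) (n<2^n n)) (m≤m+n _ 0)))

-- The exponent is spent in two parts: `N * p` absorbs the constant, and `6 * p` absorbs the sixth
-- power of `p`, since `p` is below `2 ^ p`.
square<exponential : ∀ c N s p → 0 < p → s ≤ c * (p * (p * p)) → 4 * (c * c) < 2 ^ N →
                     4 * (s * s) < 2 ^ suc ((N + 6) * p)
square<exponential c N s p 0<p s≤ c<2^N = begin-strict
  4 * (s * s)                                       ≤⟨ *-monoʳ-≤ 4 (*-mono-≤ s≤ s≤) ⟩
  4 * (c * p³ * (c * p³))                           ≡⟨ shape c p³ ⟩
  4 * (c * c) * (p³ * p³)                           <⟨ *-monoˡ-< (p³ * p³) ⦃ >-nonZero (*-mono-< 0<p³ 0<p³) ⦄ c<2^N ⟩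
  2 ^ N * (p³ * p³)                                 ≤⟨ *-mono-≤ (^-monoʳ-≤ 2 (m≤m*n N p ⦃ >-nonZero 0<p ⦄)) (*-mono-≤ p³≤ p³≤) ⟩
  2 ^ (N * p) * (2 ^ (p * 3) * 2 ^ (p * 3))         ≡⟨ cong (2 ^ (N * p) *_) (^-distribˡ-+-* 2 (p * 3) (p * 3)) ⟨
  2 ^ (N * p) * 2 ^ (p * 3 + p * 3)                 ≡⟨ ^-distribˡ-+-* 2 (N * p) (p * 3 + p * 3) ⟨
  2 ^ (N * p + (p * 3 + p * 3))                     ≡⟨ cong (2 ^_) (exponent N p) ⟩
  2 ^ ((N + 6) * p)                                 ≤⟨ m≤m+n _ _ ⟩
  2 ^ suc ((N + 6) * p)                             ∎
  where
  open ≤-Reasoning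
  p³ = p * (p * p)
  shape : ∀ c x → 4 * (c * x * (c * x)) ≡ 4 * (c * c) * (x * x)
  shape = solve-∀
  exponent : ∀ N n → N * n + (n * 3 + n * 3) ≡ (N + 6) * n
  exponent = solve-∀
  0<p³ : 0 < p³
  0<p³ = *-mono-< 0<p (*-mono-< 0<p 0<p)
  cube : ∀ x → x * (x * x) ≡ x * (x * (x * 1))
  cube = solve-∀
  p³≤ : p³ ≤ 2 ^ (p * 3)
  p³≤ = begin
    p * (p * p)                     ≤⟨ *-mono-≤ p≤ (*-mono-≤ p≤ p≤) ⟩
    2 ^ p * (2 ^ p * 2 ^ p)         ≡⟨ cube (2 ^ p) ⟩
    (2 ^ p) ^ 3                     ≡⟨ ^-*-assoc 2 p 3 ⟩
    2 ^ (p * 3)                     ∎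
    where
    p≤ : p ≤ 2 ^ p
    p≤ = <⇒≤ (n<2^n p)

bigTournament⇒tower : ∀ N m p → p ≡ suc m → let c = 40 + 96 * (N + 6) in 4 * (c * c) < 2 ^ N →
                      ∀ {k} (G : Digraph k) → IsTournament G → 2 * c * p ^ 4 ≤ k → ∃[ A ] Tower G m A
bigTournament⇒tower N m p p≡ c<2^N {k} G isT le = tournament⇒tower (square<exponential c N t p 0<p t≤ c<2^N) enough
  where
  open ≤-Reasoning
  -- With `q` equal to `2 * p` and `L` equal to `(N + 6) * p`, `t` is 40 times `p` plus
  -- `96 * (N + 6)` times its cube. As `c` is linear in `N`, its square is eventually below `2 ^ N`.
  c = 40 + 96 * (N + 6)
  0<p : 0 < p
  0<p = subst (0 <_) (sym p≡) (s≤s z≤n)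
  0<L : 0 < (N + 6) * p
  0<L = *-mono-< (≤-trans (s≤s z≤n) (m≤n+m 6 N)) 0<p
  open ThreeCores G isT m ((N + 6) * p) (2 * p) 0<L
    (subst (λ s → s + s ≤ 2 * p) p≡ (≤-reflexive (cong (p +_) (sym (+-identityʳ p)))))
  size≡ : ∀ p l → let q = 2 * p ; e = 2 * q + 4 * q * (l * p) * q in
          2 * (2 * (2 * q + e) + e) ≡ 40 * p + 96 * l * (p * (p * p))
  size≡ = solve-∀
  t≤ : t ≤ c * (p * (p * p))
  t≤ = begin
    t                                                          ≡⟨ size≡ p (N + 6) ⟩
    40 * p + 96 * (N + 6) * (p * (p * p))
      ≤⟨ +-monoˡ-≤ _ (*-monoʳ-≤ 40 (m≤m*n p (p * p) ⦃ >-nonZero (*-mono-< 0<p 0<p) ⦄)) ⟩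
    40 * (p * (p * p)) + 96 * (N + 6) * (p * (p * p))          ≡⟨ *-distribʳ-+ (p * (p * p)) 40 (96 * (N + 6)) ⟨
    c * (p * (p * p))                                          ∎
  0<t : 0 < t
  0<t = subst (0 <_) (sym (size≡ p (N + 6))) (≤-trans (*-mono-< {0} {40} (s≤s z≤n) 0<p) (m≤m+n _ _))
  shape : ∀ s m → 2 * s * m + 2 * s ≡ 2 * (s * suc m)
  shape = solve-∀
  shape′ : ∀ c x → 2 * (c * (x * (x * x)) * x) ≡ 2 * c * (x * (x * (x * (x * 1))))
  shape′ = solve-∀
  enough : 2 * t * m + 2 ≤ k
  enough = begin
    2 * t * m + 2                    ≤⟨ +-monoʳ-≤ (2 * t * m) (*-monoʳ-≤ 2 0<t) ⟩
    2 * t * m + 2 * t                ≡⟨ shape t m ⟩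
    2 * (t * suc m)                  ≡⟨ cong (λ n → 2 * (t * n)) p≡ ⟨
    2 * (t * p)                      ≤⟨ *-monoʳ-≤ 2 (*-monoˡ-≤ p t≤) ⟩
    2 * (c * (p * (p * p)) * p)      ≡⟨ shape′ c p ⟩
    2 * c * p ^ 4                    ≤⟨ le ⟩
    k                                ∎


-- From towers to the bound on compressibility

towers⇒τ≤ : ∀ c → (∀ m {k} (G : Digraph k) → IsTournament G → c * suc m ^ 4 ≤ k → ∃[ A ] Tower G m A) →
            (n : ℕ) (H : Digraph n) → IsOriented H → IsAcyclic H →
            (∀ u → outDeg H u ≤ 2) → (p : ℕ) → IsMaxPathSize H p → τ≤ H (c * p ^ 4)
towers⇒τ≤ c towers n H _ acyclic deg (suc m) longest = c * suc m ^ 4 , ≤-refl , hom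
  where
  hom : AllTournamentsOn H (c * suc m ^ 4)
  hom G isT with A , T ← towers m G isT ≤-refl = tower⇒τ H acyclic deg m longest G T
-- Path size 0 occurs only for the empty graph, since a single vertex is already a path.
towers⇒τ≤ c towers zero H _ _ _ zero _ = 0 , z≤n , λ _ _ → (λ ()) , λ ()
towers⇒τ≤ c towers (suc n) H _ _ _ zero (_ , longest) = contradiction (longest 1 singleton) 1+n≰n
  where
  singleton : DirPath H 1
  singleton = (λ _ → Fin.zero) , (λ { {Fin.zero} {Fin.zero} _ → refl }) , λ { Fin.zero Fin.zero () }

-- With N = 26 the constant in bigTournament⇒tower is c = 3112, and 4 c² < 2 ^ 26.
constant-small : 4 * ((40 + 96 * (26 + 6)) * (40 + 96 * (26 + 6))) < 2 ^ 26
constant-small = <ᵇ⇒< (4 * ((40 + 96 * (26 + 6)) * (40 + 96 * (26 + 6)))) (2 ^ 26) tt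

theorem11 : ∃[ c ] ((n : ℕ) (H : Digraph n) → IsOriented H → IsAcyclic H →
    (∀ u → outDeg H u ≤ 2) → (p : ℕ) → IsMaxPathSize H p → τ≤ H (c * p ^ 4))
theorem11 = 2 * (40 + 96 * (26 + 6)) ,
  towers⇒τ≤ (2 * (40 + 96 * (26 + 6)))
    (λ m G isT le → bigTournament⇒tower 26 m (suc m) refl constant-small G isT le)
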